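{- The graph class $\{Q_n : n\ge 1\}$ is not tree-width fragile.
   Context: For an integer $n\ge 1$, $Q_n$ is the simple undirected graph with vertex set $\{(x,y,z)\in\mathbb{Z}^3: 0\le x,y,z\le n-1\}$ in which two distinct vertices are adjacent if they can be named $(x,y,z)$ and $(x',y',z')$ in such a way that $x\le x'\le x+1$, $y\le y'\le y+1$ and $z\le z'\le z+1$. The tree-width $\operatorname{tw}(G)$ of a graph $G$ is the minimum width of its tree decompositions, where the width of a tree decomposition is the maximum size of its bags minus one. A class $\mathcal{G}$ of graphs is tree-width fragile if for every integer $k\ge 1$ there exists $t_k\ge 0$ such that for every graph $G\in\mathcal{G}$ there exist pairwise disjoint sets $A_1,\ldots,A_k\subseteq V(G)$ satisfying $\operatorname{tw}(G-A_i)\le t_k$ for $1\le i\le k$. -}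

module Defs where

open import Data.Nat.Base using (ℕ; suc; _≤_; _^_)
open import Data.Nat.Properties using (_≤?_)
open import Data.Integer.Base as ℤ using (ℤ; +_; 1ℤ)
open import Data.Fin.Base using (Fin; zero; suc; toℕ; finToFun)
open import Data.Fin.Properties using (_≟_; all?)
open import Data.Fin.Subset using (Subset; inside; outside; _∈_; _∩_; ∁; Empty; ∣_∣)
open import Data.List.Base as List using (List; []; _∷_; _∷ʳ_; length)
open import Data.List.Extrema.Nat using (max)
open import Data.List.Relation.Unary.Linked using (Linked)
open import Data.List.Relation.Unary.Unique.Propositional using (Unique)
open import Data.Product.Base using (Σ-syntax; ∃-syntax; _×_; _,_)
open import Data.Sum.Base using (_⊎_; swap)
open import Data.Vec.Base as Vec using ([]; _∷_)
open import Function.Base using (_on_)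
open import Level using (Level; 0ℓ; _⊔_) renaming (suc to lsuc)
open import Relation.Binary.Construct.Closure.ReflexiveTransitive using (Star)
open import Relation.Binary.Core using (Rel)
open import Relation.Binary.Definitions using (Decidable; Irreflexive; Symmetric)
open import Relation.Binary.PropositionalEquality using (_≡_; _≢_; sym; cong)
open import Relation.Nullary using (¬_; ¬?; _×-dec_; _⊎-dec_)
open import Relation.Unary using (Pred)

-- Finite simple undirected graphs, with vertices numbered so that vertex sets
-- are the library's `Subset order`.
record Graph : Set₁ where
  field
    order      : ℕ
    Adj        : Rel (Fin order) 0ℓ
    adj?       : Decidable Adj
    adj-sym    : Symmetric Adj
    adj-irrefl : Irreflexive _≡_ Adj

  Vertex : Set
  Vertex = Fin order

  VertexSet : Set
  VertexSet = Subset order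

open Graph public using (Vertex; VertexSet)

-- `nth S i` is the i-th smallest element of S; it identifies Fin ∣ S ∣ with S.
nth : ∀ {n} (S : Subset n) → Fin ∣ S ∣ → Fin n
nth (inside  ∷ S) zero    = zero
nth (inside  ∷ S) (suc i) = suc (nth S i)
nth (outside ∷ S) i       = suc (nth S i)

induced : (G : Graph) → VertexSet G → Graph
induced G S = record
  { order      = ∣ S ∣
  ; Adj        = Adj on nth S
  ; adj?       = λ u v → adj? (nth S u) (nth S v)
  ; adj-sym    = adj-sym
  ; adj-irrefl = λ u≡v → adj-irrefl (cong (nth S) u≡v)
  }
  where open Graph G

infixl 8 _∖_
_∖_ : (G : Graph) → VertexSet G → Graph
G ∖ A = induced G (∁ A)

Connected : Graph → Set
Connected G = ∀ u v → Star (Graph.Adj G) u v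

-- The cycle u v₁ … vₘ u has m + 1 ≥ 3 distinct vertices.
IsCycle : (G : Graph) → Vertex G → List (Vertex G) → Set
IsCycle G u vs = 2 ≤ length vs × Unique (u ∷ vs) × Linked (Graph.Adj G) (u ∷ (vs ∷ʳ u))

record IsTree (T : Graph) : Set where
  field
    nonempty  : 1 ≤ Graph.order T
    connected : Connected T
    acyclic   : ∀ u vs → ¬ IsCycle T u vs

record TreeDecomposition (G : Graph) : Set₁ where
  field
    tree   : Graph
    isTree : IsTree tree
    bag    : Vertex tree → VertexSet G

  nodesOf : Vertex G → VertexSet tree
  nodesOf v = Vec.tabulate (λ t → Vec.lookup (bag t) v)

  field
    vertex-covered  : ∀ v → ∃[ t ] v ∈ bag t
    edge-covered    : ∀ u v → Graph.Adj G u v → ∃[ t ] (u ∈ bag t × v ∈ bag t)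
    nodes-connected : ∀ v → Connected (induced tree (nodesOf v))

  -- Integer-valued: the decomposition of the empty graph into empty bags has
  -- width -1.
  width : ℤ
  width = + max 0 (List.tabulate (λ t → ∣ bag t ∣)) ℤ.- 1ℤ

open TreeDecomposition public using (width)

-- `IsTreewidth G w` says tw(G) = w.  Tree-width is a relation because the
-- minimum ranges over infinitely many decompositions.
record IsTreewidth (G : Graph) (w : ℤ) : Set₁ where
  field
    attained : Σ[ D ∈ TreeDecomposition G ] width D ≡ w
    minimal  : (D : TreeDecomposition G) → w ℤ.≤ width D

tw[_]≤_ : Graph → ℕ → Set₁
tw[ G ]≤ t = ∃[ w ] (IsTreewidth G w × w ℤ.≤ + t)

GraphClass : (ℓ : Level) → Set (lsuc 0ℓ ⊔ lsuc ℓ)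
GraphClass ℓ = Pred Graph ℓ

PairwiseDisjoint : ∀ {k n} → (Fin k → Subset n) → Set
PairwiseDisjoint A = ∀ i j → i ≢ j → Empty (A i ∩ A j)

TreewidthFragile : ∀ {ℓ} → GraphClass ℓ → Set (lsuc 0ℓ ⊔ ℓ)
TreewidthFragile 𝒢 =
  ∀ (k : ℕ) → 1 ≤ k →
  Σ[ t ∈ ℕ ] (∀ (G : Graph) → 𝒢 G →
    Σ[ A ∈ (Fin k → VertexSet G) ] (PairwiseDisjoint A × (∀ i → tw[ G ∖ A i ]≤ t)))

-- The points of {0,…,n-1}³ are numbered by the library's bijection `finToFun`
-- between Fin (n ^ 3) and Fin 3 → Fin n.
coord : ∀ n → Fin (n ^ 3) → Fin 3 → ℕ
coord n p i = toℕ (finToFun {n} {3} p i)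

Step : ∀ n → Rel (Fin (n ^ 3)) 0ℓ
Step n p q = ∀ i → coord n p i ≤ coord n q i × coord n q i ≤ suc (coord n p i)

step? : ∀ n → Decidable (Step n)
step? n p q = all? (λ i → (coord n p i ≤? coord n q i) ×-dec (coord n q i ≤? suc (coord n p i)))

Q : ℕ → Graph
Q n = record
  { order      = n ^ 3
  ; Adj        = λ p q → p ≢ q × (Step n p q ⊎ Step n q p)
  ; adj?       = λ p q → ¬? (p ≟ q) ×-dec (step? n p q ⊎-dec step? n q p)
  ; adj-sym    = λ (p≢q , s) → (λ q≡p → p≢q (sym q≡p)) , swap s
  ; adj-irrefl = λ p≡q (p≢q , _) → p≢q p≡q
  }

𝒬 : GraphClass (lsuc 0ℓ)
𝒬 G = ∃[ n ] (1 ≤ n × G ≡ Q n)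

{-# OPTIONS --safe #-}
module Submission where

-- Two disjoint sets suffice.  Let A be the first one and B its complement; B has
-- bounded tree-width, and so has A, being part of the complement of the second
-- set.  As degrees are bounded, A has a 2-colouring with bounded monochromatic
-- components; contract each of them to one of its vertices.  Triangles in A then
-- collapse.  Label the vertices by four regions that meet only near a point p and
-- count, modulo 2, the rainbow tetrahedra of the Kuhn triangulation that meet a
-- subset P of B.  If P is separated from the rest of B by a few vertices X,
-- a Sperner-type argument pushes this count along a ray from p that avoids X to a
-- face of the cube, so the count does not depend on the position of p on the ray.
-- For the branches P of a rooted tree decomposition of B, two such moves take p
-- away from any given bag, where the vertices of the bag do not contribute; so the
-- count is additive over branches, and it is 0 for all of B.  But every rainbow
-- tetrahedron meets B, and by Sperner's lemma their number is odd.

open import Defs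
open import Data.Bool.Base using (Bool; true; false; _∨_; _∧_; _xor_; T; not; if_then_else_)
open import Data.Bool.Properties using (T?; T-∨; not-¬; xor-same; xor-identityʳ;
  ∧-zeroʳ; ∨-identityʳ; ∧-distribʳ-xor) renaming (_≟_ to _≟ᵇ_)
open import Data.Bool.Solver using (module xor-∧-Solver; module ∨-∧-Solver)
open import Data.Empty using (⊥; ⊥-elim)
open import Data.Fin.Base using (Fin; zero; suc; toℕ; fromℕ<; combine; funToFin; finToFun)
open import Data.Fin.Patterns using (0F; 1F; 2F; 3F)
import Data.Fin.Properties as Fin
open import Data.Fin.Subset as Subset using (Subset; ∣_∣; ∁; inside; outside)
import Data.Fin.Subset.Properties as Subset
open import Data.Integer.Base as ℤ using (1ℤ)
import Data.Integer.Properties as ℤ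
open import Data.List.Base as List using (List; []; _∷_; _∷ʳ_; _++_; length; map; filter; concatMap; allFin; cartesianProductWith)
open import Data.List.Extrema.Nat using (max; xs≤max)
import Data.List.Membership.DecPropositional as DecMembership
open import Data.List.Membership.Propositional using (_∈_; _∉_; lose; find)
open import Data.List.Membership.Propositional.Properties using (∈-++⁺ˡ; ∈-++⁺ʳ; ∈-++⁻;
  ∈-map⁺; ∈-map⁻; ∈-filter⁺; ∈-concatMap⁺;
  ∈-cartesianProductWith⁺; ∈-tabulate⁺; ∈-allFin)
open import Data.List.Properties using (length-++; length-map; length-tabulate; filter-notAll)
open import Data.List.Relation.Unary.All as All using (All; []; _∷_)
open import Data.List.Relation.Unary.All.Properties using (∷ʳ⁺)
open import Data.List.Relation.Unary.AllPairs using (AllPairs; []; _∷_)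
open import Data.List.Relation.Unary.Any as Any using (Any; here; there; any?)
open import Data.List.Relation.Unary.Linked using (Linked; [-]; _∷_)
open import Data.List.Relation.Unary.Unique.Propositional using (Unique)
import Data.List.Relation.Unary.Unique.Propositional.Properties as Unique
open import Data.Nat.Base using (ℕ; zero; suc; _≤_; _<_; z≤n; s≤s; s≤s⁻¹; _+_; _*_; _∸_)
open import Data.Nat.DivMod using (_mod_; m<n⇒m%n≡m)
open import Data.Nat.Properties hiding (_≟_)
open import Data.Nat.Solver using (module +-*-Solver)
open import Data.Product.Base using (∃-syntax; _×_; _,_; proj₁; proj₂)
open import Data.Sum.Base using (_⊎_; inj₁; inj₂; [_,_]′; swap)
import Data.Vec.Base as Vec
open Vec using ([]; _∷_)
import Data.Vec.Properties as Vec
open import Function.Base using (_∘_)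
open import Function.Bundles using (Equivalence)
open import Level using (0ℓ)
open import Relation.Binary.Construct.Closure.ReflexiveTransitive using (Star; ε; _◅_; gmap)
open import Relation.Binary.Core using (Rel)
open import Relation.Binary.Definitions using (Decidable; DecidableEquality; Symmetric)
open import Relation.Binary.PropositionalEquality
open import Relation.Nullary using (¬_; Dec; yes; no; does; ¬?; _×-dec_; _⊎-dec_; _→-dec_; contradiction)
open import Relation.Nullary.Decidable using (⌊_⌋; toWitness; fromWitness; from-yes; dec-false)
open import Relation.Unary using () renaming (Decidable to Decidable₁)

open +-*-Solver using (solve; _:+_; _:=_; con)
open xor-∧-Solver using () renaming (solve to xor-solve; _:+_ to _:⊕_; _:=_ to _⊜_)
open ∨-∧-Solver using () renaming (solve to ∨-solve; _:+_ to _:∨_; _:=_ to _≗ᵇ_)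

-- Rooted tree decompositions

-- Contraction is what keeps doors inside B: among three mutually adjacent vertices outside B two
-- have the same colour, hence a common image, so the triangle never shows three labels. It moves
-- vertices by at most r, a bound that depends on degree and tree-width only; therefore p stays more
-- than r away from the faces of the cube, and statements about labels hold up to distance r + 1.
-- Triangles labelled 1, 2, 3 lie near the plane y = py, those labelled 0, 2, 3 near the plane x =
-- px. So one coordinate of p that is far from X already seals a branch against the doors of one
-- kind, and the other coordinate can be changed at will. It is changed to a value that is far from
-- X as well, which releases the first coordinate. Hence two moves lead from a position that is good
-- for X to one that is good for X and for the bag Y below it; the height of p never changes. X and
-- Y have at most 2w vertices together. Each of them spoils at most one of 2w + 1 well-spaced values
-- of a coordinate, and this fixes the side of the cube.

private
  variable
    A : Set

Sub : Set → Set
Sub A = A → Bool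

infix 4 _∊_ _∊?_
_∊_ : A → Sub A → Set
v ∊ D = T (D v)

_∊?_ : (v : A) (D : Sub A) → Dec (v ∊ D)
v ∊? D = T? (D v)

∉⇒false : ∀ (P : Sub A) {v} → ¬ v ∊ P → P v ≡ false
∉⇒false P {v} v∉P with P v
... | true  = ⊥-elim (v∉P _)
... | false = refl

∊⇒true : ∀ (P : Sub A) {v} → v ∊ P → P v ≡ true
∊⇒true P {v} v∊P with true ← P v = refl

∅ : Sub A
∅ _ = false

infixr 6 _∪_
_∪_ : Sub A → Sub A → Sub A
(D ∪ E) v = D v ∨ E v

module _ (D E : Sub A) {v : A} where
  ∪⁻ : v ∊ D ∪ E → v ∊ D ⊎ v ∊ E
  ∪⁻ = Equivalence.to T-∨

  ∪⁺ˡ : v ∊ D → v ∊ D ∪ E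
  ∪⁺ˡ = Equivalence.from T-∨ ∘ inj₁

  ∪⁺ʳ : v ∊ E → v ∊ D ∪ E
  ∪⁺ʳ = Equivalence.from (T-∨ {D v}) ∘ inj₂

opaque
  ⟪_⟫ : {P : A → Set} → Decidable₁ P → Sub A
  ⟪ P? ⟫ v = ⌊ P? v ⌋

  ⟪⟫⁻ : {P : A → Set} {P? : Decidable₁ P} {v : A} → v ∊ ⟪ P? ⟫ → P v
  ⟪⟫⁻ = toWitness

  ⟪⟫⁺ : {P : A → Set} {P? : Decidable₁ P} {v : A} → P v → v ∊ ⟪ P? ⟫
  ⟪⟫⁺ = fromWitness

module Branches {V : Set} (_≟_ : DecidableEquality V) (Adj : Rel V 0ℓ) (Asym : Symmetric Adj)
  (B : Sub V) (w : ℕ) where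

  open DecMembership _≟_ using (_∈?_)

  infix 7 _─_
  _─_ : List V → List V → Sub V
  Y ─ X = ⟪ (λ v → (v ∈? Y) ×-dec ¬? (v ∈? X)) ⟫

  ─⁻ : ∀ {X Y v} → v ∊ Y ─ X → v ∈ Y × v ∉ X
  ─⁻ = ⟪⟫⁻

  ─⁺ : ∀ {X Y v} → v ∈ Y → v ∉ X → v ∊ Y ─ X
  ─⁺ v∈Y v∉X = ⟪⟫⁺ (v∈Y , v∉X)

  -- Separation is meant in the subgraph on B; edges to vertices outside B are free.
  Closed : Sub V → List V → Set
  Closed D X = ∀ {d u} → d ∊ D → u ∊ B → Adj d u → u ∊ D ⊎ u ∈ X

  Avoids : Sub V → List V → Set
  Avoids D X = ∀ {v} → v ∊ D → v ∉ X

  -- `Branch X D`: in a rooted tree decomposition of the subgraph on B with bags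
  -- of size at most w, D consists of the vertices that occur only in some of
  -- the branches hanging below the bag X.
  data Branch : List V → Sub V → Set where
    nil  : ∀ {X} → Branch X ∅
    join : ∀ {X D E} → Branch X D → Branch X E →
           (∀ {v} → v ∊ D → ¬ v ∊ E) → Branch X (D ∪ E)
    up   : ∀ {X Y D} → Branch Y D → length Y ≤ w → (∀ {v} → v ∈ Y → v ∊ B) → Avoids D X →
           Closed (D ∪ Y ─ X) X → Branch X (D ∪ Y ─ X)

  branch-closed : ∀ {X D} → Branch X D → Closed D X
  branch-closed nil ()
  branch-closed (join {D = D} {E} b c _) d∊ u∊B du with ∪⁻ D E d∊
  ... | inj₁ d∊D = [ inj₁ ∘ ∪⁺ˡ D E , inj₂ ]′ (branch-closed b d∊D u∊B du)
  ... | inj₂ d∊E = [ inj₁ ∘ ∪⁺ʳ D E , inj₂ ]′ (branch-closed c d∊E u∊B du)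
  branch-closed (up _ _ _ _ closed) = closed

  branch-avoids : ∀ {X D} → Branch X D → Avoids D X
  branch-avoids nil ()
  branch-avoids (join {D = D} {E} b c _) v∊ with ∪⁻ D E v∊
  ... | inj₁ v∊D = branch-avoids b v∊D
  ... | inj₂ v∊E = branch-avoids c v∊E
  branch-avoids (up {X} {Y} {D} _ _ _ avoids _) v∊ with ∪⁻ D (Y ─ X) v∊
  ... | inj₁ v∊D  = avoids v∊D
  ... | inj₂ v∊YX = proj₂ (─⁻ v∊YX)

  branch⊆B : ∀ {X D} → Branch X D → ∀ {v} → v ∊ D → v ∊ B
  branch⊆B nil ()
  branch⊆B (join {D = D} {E} b c _) v∊ = [ branch⊆B b , branch⊆B c ]′ (∪⁻ D E v∊)
  branch⊆B (up {X} {Y} {D} b _ Y⊆B _ _) v∊ = [ branch⊆B b , Y⊆B ∘ proj₁ ∘ ─⁻ ]′ (∪⁻ D (Y ─ X) v∊)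

  -- T is grown from a single node by attaching one leaf after the other; read
  -- backwards, this prunes T leaf by leaf.
  module Pruning {Node : Set} (_≟ⁿ_ : DecidableEquality Node) (Tadj : Rel Node 0ℓ)
    (Tsym : Symmetric Tadj) (Tirr : ∀ {t} → ¬ Tadj t t)
    (bag : Node → List V) (bag≤w : ∀ t → length (bag t) ≤ w)
    (bag⊆B : ∀ t {v} → v ∈ bag t → v ∊ B)
    where

    data Grown : List Node → Set where
      [root] : ∀ r → Grown (r ∷ [])
      leaf   : ∀ {ts u a} → Grown ts → u ∉ ts → a ∈ ts →
               (∀ {s} → s ∈ ts → Tadj s u → s ≡ a) → Grown (u ∷ ts)

    InBag : V → List Node → Rel Node 0ℓ
    InBag v ts s t = Tadj s t × t ∈ ts × v ∈ bag t

    -- The invariant of pruning: the bags of `ts` still satisfy the axioms of a tree decomposition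
    -- for the vertices they hold, and a vertex of B that has left all bags lies below exactly one
    -- remaining node.
    record Pruned (ts : List Node) (below : Node → Sub V) : Set where
      field
        branches : ∀ {s} → s ∈ ts → Branch (bag s) (below s)
        covered  : ∀ {v} → v ∊ B → ∃[ s ] (s ∈ ts × (v ∈ bag s ⊎ v ∊ below s))
        avoids   : ∀ {s t v} → s ∈ ts → t ∈ ts → v ∊ below s → v ∉ bag t
        disjoint : ∀ {s t v} → s ∈ ts → t ∈ ts → s ≢ t → v ∊ below s → ¬ v ∊ below t
        edges    : ∀ {x y s t} → Adj x y → s ∈ ts → t ∈ ts → x ∈ bag s → y ∈ bag t →
                   ∃[ r ] (r ∈ ts × x ∈ bag r × y ∈ bag r)
        linked   : ∀ {v s t} → s ∈ ts → t ∈ ts → v ∈ bag s → v ∈ bag t → Star (InBag v ts) s t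

    module _ {ts u a} (u∉ts : u ∉ ts) (a∈ts : a ∈ ts)
      (only : ∀ {s} → s ∈ ts → Tadj s u → s ≡ a) where

      -- A leaf is entered and left through its only neighbour, so a detour through u starts and
      -- ends at a and can be cut out.
      shortcut : ∀ {v x y} → x ∈ ts → y ∈ ts → Star (InBag v (u ∷ ts)) x y → Star (InBag v ts) x y
      shortcut x∈ y∈ ε = ε
      shortcut x∈ y∈ ((xz , there z∈ , v∈) ◅ zs) = (xz , z∈ , v∈) ◅ shortcut z∈ y∈ zs
      shortcut x∈ y∈ ((xu , here refl , v∈) ◅ ε) = ⊥-elim (u∉ts y∈)
      shortcut x∈ y∈ ((xu , here refl , v∈) ◅ (uu , here refl , _) ◅ _) = ⊥-elim (Tirr uu)
      shortcut x∈ y∈ ((xu , here refl , v∈) ◅ (uz , there z∈ , v∈z) ◅ zs)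
        with refl ← only x∈ xu | refl ← only z∈ (Tsym uz) = shortcut z∈ y∈ zs

      -- The first step away from u leads to a. Hence a vertex of `bag u` that survives in any
      -- remaining bag survives in `bag a`.
      leaf⇒parent : ∀ {v s} → s ∈ ts → Star (InBag v (u ∷ ts)) u s → v ∈ bag a
      leaf⇒parent s∈ ε = ⊥-elim (u∉ts s∈)
      leaf⇒parent s∈ ((uu , here refl , _) ◅ _) = ⊥-elim (Tirr uu)
      leaf⇒parent s∈ ((uz , there z∈ , v∈) ◅ _)
        with refl ← only z∈ (Tsym uz) = v∈

      module _ {below : Node → Sub V} (P : Pruned (u ∷ ts) below) where
        open Pruned P

        gained : Sub V
        gained = below u ∪ bag u ─ bag a

        below′ : Node → Sub V
        below′ s with s ≟ⁿ a
        ... | yes _ = below a ∪ gained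
        ... | no  _ = below s

        private
          a∈ : a ∈ u ∷ ts
          a∈ = there a∈ts

          u∈ : u ∈ u ∷ ts
          u∈ = here refl

          parent : ∀ {v s} → s ∈ ts → v ∈ bag u → v ∈ bag s → v ∈ bag a
          parent s∈ v∈u v∈s = leaf⇒parent s∈ (linked u∈ (there s∈) v∈u v∈s)

          gained-avoids : ∀ {v s} → s ∈ ts → v ∊ gained → v ∉ bag s
          gained-avoids s∈ v∊ v∈s with ∪⁻ (below u) (bag u ─ bag a) v∊
          ... | inj₁ v∊u = avoids u∈ (there s∈) v∊u v∈s
          ... | inj₂ v∊ua with ─⁻ v∊ua
          ...   | v∈u , v∉a = v∉a (parent s∈ v∈u v∈s)

          gained-below : ∀ {v s} → s ∈ ts → v ∊ gained → ¬ v ∊ below s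
          gained-below s∈ v∊ v∊s with ∪⁻ (below u) (bag u ─ bag a) v∊
          ... | inj₁ v∊u = disjoint u∈ (there s∈) (λ { refl → u∉ts s∈ }) v∊u v∊s
          ... | inj₂ v∊ua = avoids (there s∈) u∈ v∊s (proj₁ (─⁻ v∊ua))

          bag-u : ∀ {v} → v ∈ bag u → v ∊ gained ⊎ v ∈ bag a
          bag-u {v} v∈u with v ∈? bag a
          ... | yes v∈a = inj₂ v∈a
          ... | no  v∉a = inj₁ (∪⁺ʳ (below u) (bag u ─ bag a) (─⁺ v∈u v∉a))

          closed : Closed gained (bag a)
          closed d∊ y∊B dy with ∪⁻ (below u) (bag u ─ bag a) d∊
          closed d∊ y∊B dy | inj₁ d∊u with branch-closed (branches u∈) d∊u y∊B dy
          ... | inj₁ y∊u = inj₁ (∪⁺ˡ (below u) (bag u ─ bag a) y∊u)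
          ... | inj₂ y∈u = bag-u y∈u
          closed d∊ y∊B dy | inj₂ d∊ua with ─⁻ d∊ua
          ... | d∈u , d∉a with covered y∊B
          ...   | s , s∈ , inj₁ y∈s with edges dy u∈ s∈ d∈u y∈s
          ...     | _ , here refl , _ , y∈u = bag-u y∈u
          ...     | _ , there r∈ , d∈r , _ = ⊥-elim (d∉a (parent r∈ d∈u d∈r))
          closed d∊ y∊B dy | inj₂ d∊ua | d∈u , d∉a | s , here refl , inj₂ y∊s =
            inj₁ (∪⁺ˡ (below u) (bag u ─ bag a) y∊s)
          -- If y were hidden below a remaining node s, its neighbour d would lie below s or in
          -- `bag s`; the former contradicts `avoids`, the latter puts d into `bag a`.
          closed {d} {y} d∊ y∊B dy | inj₂ d∊ua | d∈u , d∉a | s , there s∈ , inj₂ y∊s =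
            ⊥-elim ([ (λ d∊s → avoids (there s∈) u∈ d∊s d∈u)
                    , (λ d∈s → d∉a (parent s∈ d∈u d∈s))
                    ]′ (branch-closed (branches (there s∈)) y∊s (bag⊆B u d∈u) (Asym dy)))

        private
          below′⁻ : ∀ s {v} → v ∊ below′ s → v ∊ below s ⊎ (s ≡ a × v ∊ gained)
          below′⁻ s v∊ with s ≟ⁿ a
          ... | no  _    = inj₁ v∊
          ... | yes refl with ∪⁻ (below a) gained v∊
          ...   | inj₁ v∊a = inj₁ v∊a
          ...   | inj₂ v∊g = inj₂ (refl , v∊g)

          below⇒below′ : ∀ s {v} → v ∊ below s → v ∊ below′ s
          below⇒below′ s v∊ with s ≟ⁿ a
          ... | no  _    = v∊
          ... | yes refl = ∪⁺ˡ (below a) gained v∊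

          gained⇒below′ : ∀ {v} → v ∊ gained → v ∊ below′ a
          gained⇒below′ v∊ with a ≟ⁿ a
          ... | no  a≢a = ⊥-elim (a≢a refl)
          ... | yes _   = ∪⁺ʳ (below a) gained v∊

        prune : Pruned ts below′
        prune = record
          { branches = branches′
          ; covered  = covered′ ∘ covered
          ; avoids   = λ {s} s∈ t∈ v∊ → [ avoids (there s∈) (there t∈) , gained-avoids t∈ ∘ proj₂ ]′ (below′⁻ s v∊)
          ; disjoint = λ {s} {t} → disjoint′ s t
          ; edges    = edges′
          ; linked   = λ s∈ t∈ v∈s v∈t → shortcut s∈ t∈ (linked (there s∈) (there t∈) v∈s v∈t)
          }
          where
          branches′ : ∀ {s} → s ∈ ts → Branch (bag s) (below′ s)
          branches′ {s} s∈ with s ≟ⁿ a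
          ... | no  _    = branches (there s∈)
          ... | yes refl = join (branches a∈)
            (up (branches u∈) (bag≤w u) (bag⊆B u) (avoids u∈ a∈) closed)
            (λ v∊a v∊g → gained-below a∈ts v∊g v∊a)

          covered′ : ∀ {v} → ∃[ s ] (s ∈ u ∷ ts × (v ∈ bag s ⊎ v ∊ below s)) →
                     ∃[ s ] (s ∈ ts × (v ∈ bag s ⊎ v ∊ below′ s))
          covered′ (_ , here refl , inj₁ v∈u) = a , a∈ts , [ inj₂ ∘ gained⇒below′ , inj₁ ]′ (bag-u v∈u)
          covered′ (_ , here refl , inj₂ v∊u) =
            a , a∈ts , inj₂ (gained⇒below′ (∪⁺ˡ (below u) (bag u ─ bag a) v∊u))
          covered′ (s , there s∈ , inj₁ v∈s) = s , s∈ , inj₁ v∈s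
          covered′ (s , there s∈ , inj₂ v∊s) = s , s∈ , inj₂ (below⇒below′ s v∊s)

          disjoint′ : ∀ s t {v} → s ∈ ts → t ∈ ts → s ≢ t → v ∊ below′ s → ¬ v ∊ below′ t
          disjoint′ s t s∈ t∈ s≢t v∊s v∊t with below′⁻ s v∊s | below′⁻ t v∊t
          ... | inj₁ v∊s         | inj₁ v∊t         = disjoint (there s∈) (there t∈) s≢t v∊s v∊t
          ... | inj₁ v∊s         | inj₂ (_ , v∊g)   = gained-below s∈ v∊g v∊s
          ... | inj₂ (_ , v∊g)   | inj₁ v∊t         = gained-below t∈ v∊g v∊t
          ... | inj₂ (refl , _)  | inj₂ (refl , _)  = s≢t refl

          edges′ : ∀ {x y s t} → Adj x y → s ∈ ts → t ∈ ts → x ∈ bag s → y ∈ bag t →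
                   ∃[ r ] (r ∈ ts × x ∈ bag r × y ∈ bag r)
          edges′ xy s∈ t∈ x∈s y∈t with edges xy (there s∈) (there t∈) x∈s y∈t
          ... | r , there r∈ , x∈r , y∈r = r , r∈ , x∈r , y∈r
          ... | _ , here refl , x∈u , y∈u = a , a∈ts , parent s∈ x∈u x∈s , parent t∈ y∈u y∈t

    rootBranch : ∀ {ts below} → Grown ts → Pruned ts below →
                 ∃[ D ] (Branch [] D × (∀ {v} → v ∊ B → v ∊ D))
    rootBranch (leaf g u∉ a∈ only) P = rootBranch g (prune u∉ a∈ only P)
    -- The empty bag acts as the parent of the root; closedness then follows from D containing all
    -- of B.
    rootBranch {below = below} ([root] r) P = D , up (branches (here refl)) (bag≤w r) (bag⊆B r) (λ _ ()) closed , B⊆D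
      where
      open Pruned P

      D : Sub V
      D = below r ∪ bag r ─ []

      B⊆D : ∀ {v} → v ∊ B → v ∊ D
      B⊆D v∊B with covered v∊B
      ... | _ , here refl , inj₁ v∈r = ∪⁺ʳ (below r) (bag r ─ []) (─⁺ v∈r λ ())
      ... | _ , here refl , inj₂ v∊r = ∪⁺ˡ (below r) (bag r ─ []) v∊r

      closed : Closed D []
      closed _ u∊B _ = inj₁ (B⊆D u∊B)

-- Rooting a tree decomposition

module Growing (G : Graph) (isTree : IsTree G) where

  open Graph G using (order; Adj; adj?; adj-sym; adj-irrefl)
  open IsTree isTree
  open DecMembership (Fin._≟_ {order}) using (_∈?_)

  Node : Set
  Node = Vertex G

  data Path : Node → Node → List Node → Set where
    [_] : ∀ a → Path a a (a ∷ [])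
    _∷_ : ∀ {a b c vs} → Adj a b → Path b c vs → Path a c (a ∷ vs)

  record SimplePath (ts : List Node) (a b : Node) : Set where
    constructor simple
    field
      {trail} : List Node
      path    : Path a b trail
      unique  : Unique trail
      within  : All (_∈ ts) trail

  _∷ʳᵖ_ : ∀ {a b c vs} → Path a b vs → Adj b c → Path a c (vs ∷ʳ c)
  [ a ] ∷ʳᵖ ac = ac ∷ [ _ ]
  (aa′ ∷ p) ∷ʳᵖ bc = aa′ ∷ (p ∷ʳᵖ bc)

  closing-link : ∀ {a b c vs} → Path a b vs → Adj b c → Linked Adj (vs ∷ʳ c)
  closing-link [ a ] ac = ac ∷ [-]
  closing-link (aa′ ∷ [ _ ]) bc = aa′ ∷ closing-link [ _ ] bc
  closing-link (aa′ ∷ q@(_ ∷ _)) bc = aa′ ∷ closing-link q bc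

  opening-link : ∀ {a b c vs} → Adj c a → Path a b vs → Linked Adj (vs ∷ʳ c) → Linked Adj (c ∷ (vs ∷ʳ c))
  opening-link ca [ _ ] l = ca ∷ l
  opening-link ca (_ ∷ _) l = ca ∷ l

  2≤length : ∀ {a b vs} → a ≢ b → Path a b vs → 2 ≤ length vs
  2≤length a≢b [ _ ] = ⊥-elim (a≢b refl)
  2≤length _ (_ ∷ [ _ ]) = s≤s (s≤s z≤n)
  2≤length _ (_ ∷ (_ ∷ _)) = s≤s (s≤s z≤n)

  module _ {ts : List Node} {u : Node} (u∉ts : u ∉ ts) where

    fresh : ∀ {vs} → All (_∈ ts) vs → All (u ≢_) vs
    fresh = All.map λ { v∈ refl → u∉ts v∈ }

    -- u closes the path to a cycle; `a ≢ b` guarantees two vertices on the path and thus three on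
    -- the cycle.
    no-two-neighbours : ∀ {a b} → a ≢ b → Adj a u → Adj b u → ¬ SimplePath ts a b
    no-two-neighbours a≢b au bu (simple p unique within) =
      acyclic u _ (2≤length a≢b p , fresh within ∷ unique ,
                   opening-link (adj-sym au) p (closing-link p bu))

    attach : ∀ {a b} → Adj u a → SimplePath ts a b → SimplePath (u ∷ ts) u b
    attach ua (simple p unique within) =
      simple (ua ∷ p) (fresh within ∷ unique) (here refl ∷ All.map there within)

    attachʳ : ∀ {a b} → Adj u a → SimplePath ts b a → SimplePath (u ∷ ts) b u
    attachʳ ua (simple p unique within) =
      simple (p ∷ʳᵖ adj-sym ua)
             (Unique.++⁺ unique ([] ∷ []) λ { (v∈ , here refl) → u∉ts (All.lookup within v∈) })
             (∷ʳ⁺ (All.map there within) (here refl))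

  -- One direction per pair suffices, because a cycle through u can be closed from either end; no
  -- path ever has to be reversed.
  SimplyLinked : List Node → Set
  SimplyLinked ts = ∀ {a b} → a ∈ ts → b ∈ ts → SimplePath ts a b ⊎ SimplePath ts b a

  attach-linked : ∀ {ts u a} → u ∉ ts → a ∈ ts → Adj u a → SimplyLinked ts → SimplyLinked (u ∷ ts)
  attach-linked u∉ a∈ ua linked (here refl) (here refl) =
    inj₁ (simple [ _ ] ([] ∷ []) (here refl ∷ []))
  attach-linked u∉ a∈ ua linked (here refl) (there b∈) =
    [ inj₁ ∘ attach u∉ ua , inj₂ ∘ attachʳ u∉ ua ]′ (linked a∈ b∈)
  attach-linked u∉ a∈ ua linked (there b∈) (here refl) =
    [ inj₂ ∘ attach u∉ ua , inj₁ ∘ attachʳ u∉ ua ]′ (linked a∈ b∈)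
  attach-linked u∉ a∈ ua linked (there b∈) (there c∈) =
    [ inj₁ ∘ widen , inj₂ ∘ widen ]′ (linked b∈ c∈)
    where
    widen : ∀ {ts u a b} → SimplePath ts a b → SimplePath (u ∷ ts) a b
    widen (simple p unique within) = simple p unique (All.map there within)

  exit : ∀ {ts x y} → x ∈ ts → y ∉ ts → Star Adj x y → ∃[ a ] ∃[ u ] (a ∈ ts × u ∉ ts × Adj a u)
  exit x∈ y∉ ε = ⊥-elim (y∉ x∈)
  exit {ts} x∈ y∉ (_◅_ {j = z} xz zs) with z ∈? ts
  ... | yes z∈ = exit z∈ y∉ zs
  ... | no  z∉ = _ , z , x∈ , z∉ , xz

  module _ {V : Set} (_≟_ : DecidableEquality V) (VAdj : Rel V 0ℓ) (Vsym : Symmetric VAdj)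
    (B : Sub V) (w : ℕ)
    (bag : Node → List V) (bag≤w : ∀ t → length (bag t) ≤ w)
    (bag⊆B : ∀ t {v} → v ∈ bag t → v ∊ B) where

    open Branches {V} _≟_ VAdj Vsym B w
    open Pruning (Fin._≟_ {order}) Adj adj-sym (adj-irrefl refl) bag bag≤w bag⊆B using (Grown; [root]; leaf)

    -- `L` lists the nodes that may still be missing. The node attached is the first one outside
    -- `ts` on a walk towards the head x of `L`, so x stays on the list unless it is that node
    -- itself.
    grow : ∀ k L {r ts} → length L ≤ k → r ∈ ts → Grown ts → SimplyLinked ts →
           (∀ t → t ∈ ts ⊎ t ∈ L) → ∃[ ts ] (Grown ts × (∀ t → t ∈ ts))
    grow k [] _ _ g _ all = _ , g , λ t → [ (λ t∈ → t∈) , (λ ()) ]′ (all t)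
    grow (suc k) (x ∷ L) {r} {ts} L≤k r∈ g linked all with x ∈? ts
    ... | yes x∈ = grow k L (s≤s⁻¹ L≤k) r∈ g linked all′
      where
      all′ : ∀ t → t ∈ ts ⊎ t ∈ L
      all′ t with all t
      ... | inj₁ t∈            = inj₁ t∈
      ... | inj₂ (here refl)   = inj₁ x∈
      ... | inj₂ (there t∈)    = inj₂ t∈
    ... | no x∉ with exit r∈ x∉ (connected r x)
    ...   | a , u , a∈ , u∉ , au =
      grow k (filter (¬? ∘ (Fin._≟ u)) (x ∷ L))
        (s≤s⁻¹ (≤-trans (filter-notAll (¬? ∘ (Fin._≟ u)) (x ∷ L) u∈L) L≤k))
        (there r∈) (leaf g u∉ a∈ only)
        (attach-linked u∉ a∈ (adj-sym au) linked) all′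
      where
      u∈L : Any.Any (λ t → ¬ ¬ t ≡ u) (x ∷ L)
      u∈L = [ ⊥-elim ∘ u∉ , Any.map (λ { refl u≢u → u≢u refl }) ]′ (all u)

      only : ∀ {s} → s ∈ ts → Adj s u → s ≡ a
      only {s} s∈ su with s Fin.≟ a
      ... | yes s≡a = s≡a
      ... | no  s≢a = ⊥-elim ([ no-two-neighbours u∉ s≢a su au
                              , no-two-neighbours u∉ (s≢a ∘ sym) au su ]′ (linked s∈ a∈))

      all′ : ∀ t → t ∈ u ∷ ts ⊎ t ∈ filter (¬? ∘ (Fin._≟ u)) (x ∷ L)
      all′ t with all t | t Fin.≟ u
      ... | _       | yes refl = inj₁ (here refl)
      ... | inj₁ t∈ | no  _    = inj₁ (there t∈)
      ... | inj₂ t∈ | no  t≢u  = inj₂ (∈-filter⁺ (¬? ∘ (Fin._≟ u)) t∈ t≢u)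

    grown : ∃[ ts ] (Grown ts × (∀ t → t ∈ ts))
    grown = grow _ (allFin order) ≤-refl (here refl) ([root] root)
      (λ { (here refl) (here refl) → inj₁ (simple [ _ ] ([] ∷ []) (here refl ∷ [])) })
      (λ t → inj₂ (∈-allFin t))
      where
      root : Node
      root = fromℕ< nonempty

nth-∈ : ∀ {n} (S : Subset n) i → nth S i Subset.∈ S
nth-∈ (inside  ∷ S) zero    = Vec.here
nth-∈ (inside  ∷ S) (suc i) = Vec.there (nth-∈ S i)
nth-∈ (outside ∷ S) i       = Vec.there (nth-∈ S i)

nth-surjective : ∀ {n} (S : Subset n) {x} → x Subset.∈ S → ∃[ i ] nth S i ≡ x
nth-surjective (inside  ∷ S) Vec.here = zero , refl
nth-surjective (inside  ∷ S) (Vec.there x∈) with i , refl ← nth-surjective S x∈ = suc i , refl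
nth-surjective (outside ∷ S) (Vec.there x∈) with i , refl ← nth-surjective S x∈ = i , refl

nth-injective : ∀ {n} (S : Subset n) {i j} → nth S i ≡ nth S j → i ≡ j
nth-injective (inside  ∷ S) {zero}  {zero}  _  = refl
nth-injective (inside  ∷ S) {suc i} {suc j} eq = cong suc (nth-injective S (Fin.suc-injective eq))
nth-injective (outside ∷ S) eq = nth-injective S (Fin.suc-injective eq)

elements : ∀ {n} → Subset n → List (Fin n)
elements S = map (nth S) (allFin ∣ S ∣)

length-elements : ∀ {n} (S : Subset n) → length (elements S) ≡ ∣ S ∣
length-elements S = trans (length-map (nth S) (allFin ∣ S ∣)) (length-tabulate (λ i → i))

∈-elements⁺ : ∀ {n} (S : Subset n) {x} → x Subset.∈ S → x ∈ elements S
∈-elements⁺ S x∈ with i , refl ← nth-surjective S x∈ = ∈-map⁺ (nth S) (∈-allFin i)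

∈-elements⁻ : ∀ {n} (S : Subset n) {x} → x ∈ elements S → x Subset.∈ S
∈-elements⁻ S x∈ with i , _ , refl ← ∈-map⁻ (nth S) x∈ = nth-∈ S i

-- `VAdj` will be a reflexive adjacency; hence the alternative `x ≡ y` in `ι-adj`.
module Rooting (G : Graph) (TD : TreeDecomposition G)
  {V : Set} (_≟_ : DecidableEquality V) (VAdj : Rel V 0ℓ) (Vsym : Symmetric VAdj) (B : Sub V)
  (ι : Vertex G → V) (ι-injective : ∀ {x y} → ι x ≡ ι y → x ≡ y)
  (ι∊B : ∀ x → ι x ∊ B) (ι-onto : ∀ {v} → v ∊ B → ∃[ x ] ι x ≡ v)
  (ι-adj : ∀ {x y} → VAdj (ι x) (ι y) → x ≡ y ⊎ Graph.Adj G x y)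
  (w : ℕ) (bag≤w : ∀ t → ∣ TreeDecomposition.bag TD t ∣ ≤ w) where

  open TreeDecomposition TD
  open Branches {V} _≟_ VAdj Vsym B w using (Branch; nil)

  bagList : Vertex tree → List V
  bagList t = map ι (elements (bag t))

  ∈-bagList⁺ : ∀ {x t} → x Subset.∈ bag t → ι x ∈ bagList t
  ∈-bagList⁺ {t = t} x∈ = ∈-map⁺ ι (∈-elements⁺ (bag t) x∈)

  ∈-bagList⁻ : ∀ {v} t → v ∈ bagList t → ∃[ x ] (ι x ≡ v × x Subset.∈ bag t)
  ∈-bagList⁻ t v∈ with x , x∈ , refl ← ∈-map⁻ ι v∈ = x , refl , ∈-elements⁻ (bag t) x∈

  bagList≤w : ∀ t → length (bagList t) ≤ w
  bagList≤w t = ≤-trans (≤-reflexive (trans (length-map ι (elements (bag t))) (length-elements (bag t)))) (bag≤w t)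

  bagList⊆B : ∀ t {v} → v ∈ bagList t → v ∊ B
  bagList⊆B t v∈ with x , refl , _ ← ∈-bagList⁻ t v∈ = ι∊B x

  open Growing tree isTree using (grown)
  open Branches.Pruning {V} _≟_ VAdj Vsym B w (Fin._≟_ {Graph.order tree}) (Graph.Adj tree)
    (Graph.adj-sym tree) (Graph.adj-irrefl tree refl) bagList bagList≤w bagList⊆B
    using (Pruned; InBag; rootBranch)

  nodesOf⁺ : ∀ {x t} → x Subset.∈ bag t → t Subset.∈ nodesOf x
  nodesOf⁺ {x} {t} x∈ = Vec.lookup⇒[]= t _ (trans (Vec.lookup∘tabulate _ t) (Vec.[]=⇒lookup x∈))

  nodesOf⁻ : ∀ {x t} → t Subset.∈ nodesOf x → x Subset.∈ bag t
  nodesOf⁻ {x} {t} t∈ = Vec.lookup⇒[]= x _ (trans (sym (Vec.lookup∘tabulate _ t)) (Vec.[]=⇒lookup t∈))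

  rooted : ∃[ D ] (Branch [] D × (∀ {v} → v ∊ B → v ∊ D))
  rooted with ts , g , all ← grown _≟_ VAdj Vsym B w bagList bagList≤w bagList⊆B = rootBranch {below = λ _ → ∅} g (record
    { branches = λ _ → nil
    ; covered  = covered
    ; avoids   = λ _ _ ()
    ; disjoint = λ _ _ _ ()
    ; edges    = edges
    ; linked   = linked
    })
    where
    covered : ∀ {v} → v ∊ B → ∃[ s ] (s ∈ ts × (v ∈ bagList s ⊎ v ∊ ∅))
    covered v∊B with x , refl ← ι-onto v∊B with t , x∈ ← vertex-covered x =
      t , all t , inj₁ (∈-bagList⁺ x∈)

    edges : ∀ {u v s t} → VAdj u v → s ∈ ts → t ∈ ts → u ∈ bagList s → v ∈ bagList t →
            ∃[ r ] (r ∈ ts × u ∈ bagList r × v ∈ bagList r)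
    edges {s = s} {t} uv s∈ t∈ u∈ v∈
      with x , refl , x∈ ← ∈-bagList⁻ s u∈ | y , refl , y∈ ← ∈-bagList⁻ t v∈ with ι-adj uv
    ... | inj₁ refl = s , s∈ , u∈ , u∈
    ... | inj₂ xy with r , x∈r , y∈r ← edge-covered x y xy = r , all r , ∈-bagList⁺ x∈r , ∈-bagList⁺ y∈r

    linked : ∀ {v s t} → s ∈ ts → t ∈ ts → v ∈ bagList s → v ∈ bagList t → Star (InBag v ts) s t
    linked {s = s} {t} _ _ v∈s v∈t
      with x , refl , x∈s ← ∈-bagList⁻ s v∈s | y , eq , y∈t ← ∈-bagList⁻ t v∈t
      with refl ← ι-injective eq
      with i , refl ← nth-surjective (nodesOf x) (nodesOf⁺ x∈s)
         | j , refl ← nth-surjective (nodesOf x) (nodesOf⁺ y∈t) =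
      gmap (nth (nodesOf x)) (λ {_} {k} st → st , all _ , ∈-bagList⁺ (nodesOf⁻ (nth-∈ (nodesOf x) k)))
        (nodes-connected x i j)

-- Bounded clusters in graphs of bounded degree and tree-width

-- When v joins k vertices, a member u of an old cluster that touches v is reached from v by one
-- edge, then to the old centre and on to u: 1 + 2 `radius k`.
radius : ℕ → ℕ
radius zero    = 0
radius (suc k) = suc (radius k) + radius k

radius-mono : ∀ {k l} → k ≤ l → radius k ≤ radius l
radius-mono z≤n     = z≤n
radius-mono (s≤s p) = +-mono-≤ (s≤s (radius-mono p)) (radius-mono p)

module _ (Δ w : ℕ) where

  -- A piece is attached to at most two bags, hence sees at most 2wΔ vertices
  -- that have to be marked.
  markBound : ℕ
  markBound = suc ((w + w) * Δ)

  opaque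
    -- The argument of `radius` bounds the number of vertices of the set R in `partition-step`.
    radiusBound : ℕ
    radiusBound = radius (markBound * ((w + w) + (w + w)))

    radius≤bound : ∀ {k} → k ≤ markBound * ((w + w) + (w + w)) → radius k ≤ radiusBound
    radius≤bound = radius-mono

module Colouring {V : Set} (_≟_ : DecidableEquality V)
  (Adj : Rel V 0ℓ) (Asym : Symmetric Adj) (Adj? : Decidable Adj)
  (Δ : ℕ) (nbrs : V → List V) (nbrs≤Δ : ∀ v → length (nbrs v) ≤ Δ)
  (∈-nbrs : ∀ {u v} → Adj u v → v ∈ nbrs u)
  (Near : ℕ → Rel V 0ℓ) (near-refl : ∀ {v} → Near 0 v v) (near-sym : ∀ {k} → Symmetric (Near k))
  (near-mono : ∀ {k l u v} → k ≤ l → Near k u v → Near l u v)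
  (near-trans : ∀ {k l u v x} → Near k u v → Near l v x → Near (k + l) u x)
  (adj⇒near : ∀ {u v} → Adj u v → Near 1 u v)
  (B : Sub V) (w : ℕ) where

  open DecMembership _≟_ using (_∈?_)
  open Branches _≟_ Adj Asym B w

  -- A union-find on R: a new vertex v merges all clusters that it touches and becomes their centre.
  -- The result is constant on the components of the subgraph induced on R.
  centre : List V → V → V
  touches? : ∀ (v : V) (R : List V) u → Dec (u ≡ v ⊎ Any (λ x → centre R x ≡ centre R u × Adj x v) R)

  centre []      u = u
  centre (v ∷ R) u with touches? v R u
  ... | yes _ = v
  ... | no  _ = centre R u

  touches? v R u = (u ≟ v) ⊎-dec any? (λ x → (centre R x ≟ centre R u) ×-dec Adj? x v) R

  centre-cons : ∀ v R {u u′} → u ∈ R → u′ ∈ R → Adj u u′ → centre R u ≡ centre R u′ →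
                centre (v ∷ R) u ≡ centre (v ∷ R) u′
  centre-cons v R {u} {u′} u∈ u′∈ uu′ eq with touches? v R u | touches? v R u′
  ... | yes _ | yes _ = refl
  ... | no  _ | no  _ = eq
  ... | yes (inj₁ refl) | no ¬t = ⊥-elim (¬t (inj₂ (lose u′∈ (refl , Asym uu′))))
  ... | yes (inj₂ t)    | no ¬t = ⊥-elim (¬t (inj₂ (Any.map (λ (e , a) → trans e eq , a) t)))
  ... | no ¬t | yes (inj₁ refl) = ⊥-elim (¬t (inj₂ (lose u∈ (refl , uu′))))
  ... | no ¬t | yes (inj₂ t)    = ⊥-elim (¬t (inj₂ (Any.map (λ (e , a) → trans e (sym eq) , a) t)))

  centre-new : ∀ v R {u} → u ≡ v ⊎ (u ∈ R × Adj u v) → centre (v ∷ R) u ≡ v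
  centre-new v R {u} new with touches? v R u
  ... | yes _ = refl
  ... | no ¬t = ⊥-elim ([ ¬t ∘ inj₁ , (λ (u∈ , uv) → ¬t (inj₂ (lose u∈ (refl , uv)))) ]′ new)

  centre-adj : ∀ R {u u′} → u ∈ R → u′ ∈ R → Adj u u′ → centre R u ≡ centre R u′
  centre-adj (v ∷ R) (here refl) (here refl) _ = refl
  centre-adj (v ∷ R) (here refl) (there u′∈) uu′ =
    trans (centre-new v R (inj₁ refl)) (sym (centre-new v R (inj₂ (u′∈ , Asym uu′))))
  centre-adj (v ∷ R) (there u∈) (here refl) uu′ =
    trans (centre-new v R (inj₂ (u∈ , uu′))) (sym (centre-new v R (inj₁ refl)))
  centre-adj (v ∷ R) (there u∈) (there u′∈) uu′ = centre-cons v R u∈ u′∈ uu′ (centre-adj R u∈ u′∈ uu′)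

  centre-near : ∀ R u → Near (radius (length R)) (centre R u) u
  centre-near []      u = near-refl
  centre-near (v ∷ R) u with touches? v R u
  ... | no _ = near-mono (m≤n⇒m≤o+n _ ≤-refl) (centre-near R u)
  ... | yes (inj₁ refl) = near-mono z≤n near-refl
  ... | yes (inj₂ t) with x , x∈ , eq , xv ← find t =
    near-trans (near-trans (near-sym (adj⇒near xv)) (near-sym (centre-near R x)))
               (subst (λ y → Near _ y u) (sym eq) (centre-near R u))

  count : Sub V → List V → ℕ
  count D []      = 0
  count D (x ∷ W) = (if D x then 1 else 0) + count D W

  count≤length : ∀ D W → count D W ≤ length W
  count≤length D []      = z≤n
  count≤length D (x ∷ W) with D x
  ... | true  = s≤s (count≤length D W)
  ... | false = m≤n⇒m≤1+n (count≤length D W)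

  count>0 : ∀ D {W} → Any (_∊ D) W → 1 ≤ count D W
  count>0 D {x ∷ W} (here x∊D) with true ← D x = s≤s z≤n
  count>0 D {x ∷ W} (there p) = m≤n⇒m≤o+n _ (count>0 D p)

  count-∪ : ∀ D E W → (∀ {v} → v ∊ D → ¬ v ∊ E) → count D W + count E W ≤ count (D ∪ E) W
  count-∪ D E []      _ = z≤n
  count-∪ D E (x ∷ W) disjoint with D x in Dx | E x in Ex
  ... | true  | true  = ⊥-elim (disjoint {x} (subst T (sym Dx) _) (subst T (sym Ex) _))
  ... | true  | false = s≤s (count-∪ D E W disjoint)
  ... | false | true  = ≤-trans (≤-reflexive (+-suc (count D W) (count E W))) (s≤s (count-∪ D E W disjoint))
  ... | false | false = count-∪ D E W disjoint

  -- Monochromatic components are never formed as sets: a representative that is constant along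
  -- monochromatic edges and nearby bounds them. `boundary` is for gluing, as it leaves a single
  -- colour c at the rim of P.
  record Coloured (r : ℕ) (P H : Sub V) (c : Bool) : Set where
    field
      colour   : V → Bool
      rep      : V → V
      mono     : ∀ {u v} → u ∊ P → v ∊ P → Adj u v → colour u ≡ colour v → rep u ≡ rep v
      near     : ∀ {v} → v ∊ P → Near r (rep v) v
      boundary : ∀ {u v} → v ∊ P → u ∊ H → ¬ u ∊ P → Adj u v → colour v ≡ c

  coloured-∅ : ∀ {r H c} → Coloured r ∅ H c
  coloured-∅ = record { colour = λ _ → true ; rep = λ v → v ; mono = λ () ; near = λ () ; boundary = λ () }

  coloured-∪ : ∀ {r P Q H c} → Coloured r P H c → Coloured r Q H c →
               (∀ {u v} → u ∊ P → v ∊ Q → ¬ Adj u v) → Coloured r (P ∪ Q) H c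
  coloured-∪ {r} {P} {Q} {H} {c} p q apart = record
    { colour = λ v → if P v then P.colour v else Q.colour v
    ; rep    = λ v → if P v then P.rep v else Q.rep v
    ; mono   = mono
    ; near   = near
    ; boundary = boundary
    }
    where
    module P = Coloured p
    module Q = Coloured q

    mono : ∀ {u v} → u ∊ P ∪ Q → v ∊ P ∪ Q → Adj u v →
           (if P u then P.colour u else Q.colour u) ≡ (if P v then P.colour v else Q.colour v) →
           (if P u then P.rep u else Q.rep u) ≡ (if P v then P.rep v else Q.rep v)
    mono {u} {v} u∊ v∊ uv eq with P u in Pu | P v in Pv
    ... | true  | true  = P.mono (subst T (sym Pu) _) (subst T (sym Pv) _) uv eq
    ... | true  | false = ⊥-elim (apart {u} {v} (subst T (sym Pu) _) v∊ uv)
    ... | false | true  = ⊥-elim (apart {v} {u} (subst T (sym Pv) _) u∊ (Asym uv))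
    ... | false | false = Q.mono u∊ v∊ uv eq

    near : ∀ {v} → v ∊ P ∪ Q → Near r (if P v then P.rep v else Q.rep v) v
    near {v} v∊ with P v in Pv
    ... | true  = P.near (subst T (sym Pv) _)
    ... | false = Q.near v∊

    boundary : ∀ {u v} → v ∊ P ∪ Q → u ∊ H → ¬ u ∊ P ∪ Q → Adj u v →
               (if P v then P.colour v else Q.colour v) ≡ c
    boundary {u} {v} v∊ u∊H u∉ uv with P v in Pv
    ... | true  = P.boundary (subst T (sym Pv) _) u∊H (u∉ ∘ ∪⁺ˡ P Q) uv
    ... | false = Q.boundary v∊ u∊H (u∉ ∘ ∪⁺ʳ P Q) uv

  -- Splitting a branch around the marked vertices

  module Splitting (H : Sub V) (H⊆B : ∀ {v} → v ∊ H → v ∊ B) (W : List V) (r : ℕ) (c : Bool)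
    (colourPiece : (P : Sub V) (Z : List V) → (∀ {v} → v ∊ P → v ∊ H × v ∉ W) → length Z ≤ w + w →
                   (∀ {h u} → h ∊ P → u ∊ H → Adj h u → u ∊ P ⊎ u ∈ Z) → Coloured r P H c)
    where

    -- R ∪ K is the part of D dealt with so far: R is to be one part of the
    -- partition, K is a union of pieces that are coloured already, and Z
    -- separates the remainder of H from R.
    record Split (D : Sub V) (Y : List V) : Set where
      field
        R Z      : List V
        K        : Sub V
        R⊆       : ∀ {v} → v ∈ R → v ∊ D ⊎ v ∈ Y
        Z⊆R      : ∀ {v} → v ∈ Z → v ∈ R
        K⊆       : ∀ {v} → v ∊ K → v ∊ D × v ∊ H
        K∩R      : ∀ {v} → v ∊ K → v ∉ R
        coloured : Coloured r K H c
        K-closed : ∀ {k u} → k ∊ K → u ∊ H → Adj k u → u ∊ K ⊎ u ∈ R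
        R-sep    : ∀ {x u} → x ∈ R → u ∊ H → u ∉ R → ¬ u ∊ K → Adj x u → x ∈ Z
        marks    : ∀ {v} → v ∈ W → v ∊ D → v ∈ R
        Z≤w      : length Z ≤ w

    Covers : ∀ {D Y} → Split D Y → Set
    Covers {D} S = ∀ {v} → v ∊ D → v ∊ H → v ∈ R ⊎ v ∊ K
      where open Split S

    module Closing {D Y} (b : Branch Y D) (Y≤w : length Y ≤ w) (S : Split D Y) where
      open Split S

      rest? : ∀ v → Dec (v ∊ D × v ∊ H × v ∉ R × ¬ v ∊ K)
      rest? v = (v ∊? D) ×-dec (v ∊? H) ×-dec ¬? (v ∈? R) ×-dec ¬? (v ∊? K)

      rest : Sub V
      rest = ⟪ rest? ⟫

      -- Within H the rest can be left only through the bag Y or into R, and the latter only at Z.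
      -- It has no edge to K, whose own exits all lie in R.
      rest-closed : ∀ {h u} → h ∊ rest → u ∊ H → Adj h u → u ∊ rest ⊎ u ∈ Z ++ Y
      rest-closed {h} {u} h∊ u∊H hu with ⟪⟫⁻ {P? = rest?} h∊
      ... | h∊D , h∊H , h∉R , h∉K with branch-closed b h∊D (H⊆B u∊H) hu
      ...   | inj₂ u∈Y = inj₂ (∈-++⁺ʳ Z u∈Y)
      ...   | inj₁ u∊D with u ∈? R | u ∊? K
      ...     | yes u∈R | _       = inj₂ (∈-++⁺ˡ (R-sep u∈R h∊H h∉R h∉K (Asym hu)))
      ...     | no _    | yes u∊K = ⊥-elim ([ h∉K , h∉R ]′ (K-closed u∊K h∊H (Asym hu)))
      ...     | no u∉R  | no u∉K  = inj₁ (⟪⟫⁺ {P? = rest?} (u∊D , u∊H , u∉R , u∉K))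

      K∪rest⊆D : ∀ {v} → v ∊ K ∪ rest → v ∊ D × v ∊ H
      K∪rest⊆D v∊ with ∪⁻ K rest v∊
      ... | inj₁ v∊K = K⊆ v∊K
      ... | inj₂ v∊r with v∊D , v∊H , _ ← ⟪⟫⁻ {P? = rest?} v∊r = v∊D , v∊H

      -- Sacrificing the bag Y turns all that is left of D into one more piece, attached to Z and Y
      -- only; afterwards Y alone separates.
      closeOff : Split D Y
      closeOff = record
        { R        = Y ++ R
        ; Z        = Y
        ; K        = K ∪ rest
        ; R⊆       = λ v∈ → [ inj₂ , R⊆ ]′ (∈-++⁻ Y v∈)
        ; Z⊆R      = ∈-++⁺ˡ
        ; K⊆       = K∪rest⊆D
        ; K∩R      = λ v∊ v∈ → [ branch-avoids b (proj₁ (K∪rest⊆D v∊)) , K∪rest∉R v∊ ]′ (∈-++⁻ Y v∈)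
        ; coloured = coloured-∪ coloured
            (colourPiece rest (Z ++ Y) rest-unmarked
              (≤-trans (≤-reflexive (length-++ Z)) (+-mono-≤ Z≤w Y≤w)) rest-closed)
            K-rest-apart
        ; K-closed = closed
        ; R-sep    = R-sep′
        ; marks    = λ v∈W v∊D → ∈-++⁺ʳ Y (marks v∈W v∊D)
        ; Z≤w      = Y≤w
        }
        where
        K∪rest∉R : ∀ {v} → v ∊ K ∪ rest → v ∉ R
        K∪rest∉R v∊ v∈R with ∪⁻ K rest v∊
        ... | inj₁ v∊K = K∩R v∊K v∈R
        ... | inj₂ v∊r with _ , _ , v∉R , _ ← ⟪⟫⁻ {P? = rest?} v∊r = v∉R v∈R

        rest-unmarked : ∀ {v} → v ∊ rest → v ∊ H × v ∉ W
        rest-unmarked v∊r with v∊D , v∊H , v∉R , _ ← ⟪⟫⁻ {P? = rest?} v∊r = v∊H , λ v∈W → v∉R (marks v∈W v∊D)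

        K-rest-apart : ∀ {u v} → u ∊ K → v ∊ rest → ¬ Adj u v
        K-rest-apart u∊K v∊r uv with _ , v∊H , v∉R , v∉K ← ⟪⟫⁻ {P? = rest?} v∊r =
          [ v∉K , v∉R ]′ (K-closed u∊K v∊H uv)

        closed : ∀ {k u} → k ∊ K ∪ rest → u ∊ H → Adj k u → u ∊ K ∪ rest ⊎ u ∈ Y ++ R
        closed k∊ u∊H ku with ∪⁻ K rest k∊
        ... | inj₁ k∊K = [ inj₁ ∘ ∪⁺ˡ K rest , inj₂ ∘ ∈-++⁺ʳ Y ]′ (K-closed k∊K u∊H ku)
        ... | inj₂ k∊r with rest-closed k∊r u∊H ku
        ...   | inj₁ u∊r = inj₁ (∪⁺ʳ K rest u∊r)
        ...   | inj₂ u∈ZY with ∈-++⁻ Z u∈ZY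
        ...     | inj₂ u∈Y = inj₂ (∈-++⁺ˡ u∈Y)
        ...     | inj₁ u∈Z = inj₂ (∈-++⁺ʳ Y (Z⊆R u∈Z))

        R-sep′ : ∀ {x u} → x ∈ Y ++ R → u ∊ H → u ∉ Y ++ R → ¬ u ∊ K ∪ rest → Adj x u → x ∈ Y
        R-sep′ x∈ u∊H u∉ u∉K xu with ∈-++⁻ Y x∈
        ... | inj₁ x∈Y = x∈Y
        ... | inj₂ x∈R with R⊆ x∈R
        ...   | inj₂ x∈Y = x∈Y
        ...   | inj₁ x∊D with branch-closed b x∊D (H⊆B u∊H) xu
        ...     | inj₂ u∈Y = ⊥-elim (u∉ (∈-++⁺ˡ u∈Y))
        ...     | inj₁ u∊D = ⊥-elim (u∉K (∪⁺ʳ K rest (⟪⟫⁺ {P? = rest?}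
                    (u∊D , u∊H , u∉ ∘ ∈-++⁺ʳ Y , u∉K ∘ ∪⁺ˡ K rest))))

      closeOff-covers : Covers closeOff
      closeOff-covers {v} v∊D v∊H with v ∈? R | v ∊? K
      ... | yes v∈R | _       = inj₁ (∈-++⁺ʳ Y v∈R)
      ... | no _    | yes v∊K = inj₂ (∪⁺ˡ K rest v∊K)
      ... | no v∉R  | no v∉K  = inj₂ (∪⁺ʳ K rest (⟪⟫⁺ {P? = rest?} (v∊D , v∊H , v∉R , v∉K)))

    Untouched : ∀ {D Y} → Split D Y → Set
    Untouched S = R ≡ [] × Z ≡ []
      where open Split S

    -- A potential: each mark is worth 4w vertices, and 2w are always held in reserve. Merging two
    -- branches with marks adds Y twice, which is paid from the reserve of one of them.
    Bounded : ∀ {D Y} → Split D Y → Set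
    Bounded {D} S = length R + (w + w) ≤ count D W * ((w + w) + (w + w))
      where open Split S

    split-∅ : ∀ {Y} → Split ∅ Y
    split-∅ = record
      { R = [] ; Z = [] ; K = ∅ ; R⊆ = λ () ; Z⊆R = λ () ; K⊆ = λ () ; K∩R = λ ()
      ; coloured = coloured-∅ ; K-closed = λ () ; R-sep = λ () ; marks = λ _ () ; Z≤w = z≤n }

    module _ {D E Y} (b : Branch Y D) (e : Branch Y E) (disjoint : ∀ {v} → v ∊ D → ¬ v ∊ E)
      (S : Split D Y) (S′ : Split E Y) where
      private
        module S  = Split S
        module S′ = Split S′

      split-∪ : (Z : List V) → length Z ≤ w → (∀ {v} → v ∈ Z → v ∈ S.R ++ S′.R) →
                (∀ {x u} → x ∈ S.R ++ S′.R → u ∊ H → u ∉ S.R ++ S′.R → ¬ u ∊ S.K ∪ S′.K → Adj x u → x ∈ Z) →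
                Split (D ∪ E) Y
      split-∪ Z Z≤w Z⊆R R-sep = record
        { R        = S.R ++ S′.R
        ; Z        = Z
        ; K        = S.K ∪ S′.K
        ; R⊆       = λ v∈ → [ [ inj₁ ∘ ∪⁺ˡ D E , inj₂ ]′ ∘ S.R⊆ , [ inj₁ ∘ ∪⁺ʳ D E , inj₂ ]′ ∘ S′.R⊆ ]′ (∈-++⁻ S.R v∈)
        ; Z⊆R      = Z⊆R
        ; K⊆       = K⊆
        ; K∩R      = K∩R
        ; coloured = coloured-∪ S.coloured S′.coloured apart
        ; K-closed = closed
        ; R-sep    = R-sep
        ; marks    = λ v∈W v∊ → [ ∈-++⁺ˡ ∘ S.marks v∈W , ∈-++⁺ʳ S.R ∘ S′.marks v∈W ]′ (∪⁻ D E v∊)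
        ; Z≤w      = Z≤w
        }
        where
        K⊆ : ∀ {v} → v ∊ S.K ∪ S′.K → v ∊ D ∪ E × v ∊ H
        K⊆ v∊ with ∪⁻ S.K S′.K v∊
        ... | inj₁ v∊K  = ∪⁺ˡ D E (proj₁ (S.K⊆ v∊K)) , proj₂ (S.K⊆ v∊K)
        ... | inj₂ v∊K′ = ∪⁺ʳ D E (proj₁ (S′.K⊆ v∊K′)) , proj₂ (S′.K⊆ v∊K′)

        K∩R : ∀ {v} → v ∊ S.K ∪ S′.K → v ∉ S.R ++ S′.R
        K∩R v∊ v∈ with ∪⁻ S.K S′.K v∊ | ∈-++⁻ S.R v∈
        ... | inj₁ v∊K  | inj₁ v∈R  = S.K∩R v∊K v∈R
        ... | inj₂ v∊K′ | inj₂ v∈R′ = S′.K∩R v∊K′ v∈R′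
        ... | inj₁ v∊K  | inj₂ v∈R′ =
          [ disjoint (proj₁ (S.K⊆ v∊K)) , branch-avoids b (proj₁ (S.K⊆ v∊K)) ]′ (S′.R⊆ v∈R′)
        ... | inj₂ v∊K′ | inj₁ v∈R  =
          [ (λ v∊D → disjoint v∊D (proj₁ (S′.K⊆ v∊K′))) , branch-avoids e (proj₁ (S′.K⊆ v∊K′)) ]′ (S.R⊆ v∈R)

        apart : ∀ {u v} → u ∊ S.K → v ∊ S′.K → ¬ Adj u v
        apart u∊K v∊K′ uv with S′.K⊆ v∊K′
        ... | v∊E , v∊H = [ (λ v∊D → disjoint v∊D v∊E) , branch-avoids e v∊E ]′
                            (branch-closed b (proj₁ (S.K⊆ u∊K)) (H⊆B v∊H) uv)

        closed : ∀ {k u} → k ∊ S.K ∪ S′.K → u ∊ H → Adj k u → u ∊ S.K ∪ S′.K ⊎ u ∈ S.R ++ S′.R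
        closed k∊ u∊H ku with ∪⁻ S.K S′.K k∊
        ... | inj₁ k∊K  = [ inj₁ ∘ ∪⁺ˡ S.K S′.K , inj₂ ∘ ∈-++⁺ˡ ]′ (S.K-closed k∊K u∊H ku)
        ... | inj₂ k∊K′ = [ inj₁ ∘ ∪⁺ʳ S.K S′.K , inj₂ ∘ ∈-++⁺ʳ S.R ]′ (S′.K-closed k∊K′ u∊H ku)

      split-∪-untouchedˡ : Untouched S → Split (D ∪ E) Y
      split-∪-untouchedˡ (R≡[] , _) = split-∪ S′.Z S′.Z≤w (∈-++⁺ʳ S.R ∘ S′.Z⊆R) sep
        where
        sep : ∀ {x u} → x ∈ S.R ++ S′.R → u ∊ H → u ∉ S.R ++ S′.R → ¬ u ∊ S.K ∪ S′.K → Adj x u → x ∈ S′.Z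
        sep x∈ u∊H u∉R u∉K xu with ∈-++⁻ S.R x∈
        ... | inj₂ x∈R′ = S′.R-sep x∈R′ u∊H (u∉R ∘ ∈-++⁺ʳ S.R) (u∉K ∘ ∪⁺ʳ S.K S′.K) xu
        ... | inj₁ x∈R with () ← subst (_ ∈_) R≡[] x∈R

      split-∪-untouchedʳ : Untouched S′ → Split (D ∪ E) Y
      split-∪-untouchedʳ (R≡[] , _) = split-∪ S.Z S.Z≤w (∈-++⁺ˡ ∘ S.Z⊆R) sep
        where
        sep : ∀ {x u} → x ∈ S.R ++ S′.R → u ∊ H → u ∉ S.R ++ S′.R → ¬ u ∊ S.K ∪ S′.K → Adj x u → x ∈ S.Z
        sep x∈ u∊H u∉R u∉K xu with ∈-++⁻ S.R x∈
        ... | inj₁ x∈R = S.R-sep x∈R u∊H (u∉R ∘ ∈-++⁺ˡ) (u∉K ∘ ∪⁺ˡ S.K S′.K) xu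
        ... | inj₂ x∈R′ with () ← subst (_ ∈_) R≡[] x∈R′

      -- Nothing of D or E is left uncovered, so an edge from R to new vertices of H can start in Y
      -- only.
      split-∪-covered : Covers S → Covers S′ → length Y ≤ w → (∀ {v} → v ∈ Y → v ∈ S.R) → Split (D ∪ E) Y
      split-∪-covered cov cov′ Y≤w Y⊆R = split-∪ Y Y≤w (∈-++⁺ˡ ∘ Y⊆R) sep
        where
        D∪E-closed : Closed (D ∪ E) Y
        D∪E-closed = branch-closed (join b e disjoint)

        sep : ∀ {x u} → x ∈ S.R ++ S′.R → u ∊ H → u ∉ S.R ++ S′.R → ¬ u ∊ S.K ∪ S′.K → Adj x u → x ∈ Y
        sep {x} {u} x∈ u∊H u∉R u∉K xu = [ escape , (λ x∈Y → x∈Y) ]′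
          ([ [ inj₁ ∘ ∪⁺ˡ D E , inj₂ ]′ ∘ S.R⊆ , [ inj₁ ∘ ∪⁺ʳ D E , inj₂ ]′ ∘ S′.R⊆ ]′ (∈-++⁻ S.R x∈))
          where
          escape : x ∊ D ∪ E → x ∈ Y
          escape x∊ with D∪E-closed x∊ (H⊆B u∊H) xu
          ... | inj₂ u∈Y = ⊥-elim (u∉R (∈-++⁺ˡ (Y⊆R u∈Y)))
          ... | inj₁ u∊ with ∪⁻ D E u∊
          ...   | inj₁ u∊D = ⊥-elim ([ u∉R ∘ ∈-++⁺ˡ , u∉K ∘ ∪⁺ˡ S.K S′.K ]′ (cov u∊D u∊H))
          ...   | inj₂ u∊E = ⊥-elim ([ u∉R ∘ ∈-++⁺ʳ S.R , u∉K ∘ ∪⁺ʳ S.K S′.K ]′ (cov′ u∊E u∊H))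

    split-up : ∀ {X Y D} → (S : Split D Y) →
               (∀ {v} → v ∈ W → v ∊ Y ─ X → v ∈ Split.R S) → Split (D ∪ Y ─ X) X
    split-up {X} {Y} {D} S marked = record
      { R = R ; Z = Z ; K = K
      ; R⊆ = λ v∈ → [ inj₁ ∘ ∪⁺ˡ D (Y ─ X) , Y⊆ ]′ (R⊆ v∈)
      ; Z⊆R = Z⊆R
      ; K⊆ = λ v∊ → ∪⁺ˡ D (Y ─ X) (proj₁ (K⊆ v∊)) , proj₂ (K⊆ v∊)
      ; K∩R = K∩R ; coloured = coloured ; K-closed = K-closed ; R-sep = R-sep
      ; marks = λ v∈W v∊ → [ marks v∈W , marked v∈W ]′ (∪⁻ D (Y ─ X) v∊)
      ; Z≤w = Z≤w
      }
      where
      open Split S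

      Y⊆ : ∀ {v} → v ∈ Y → v ∊ D ∪ Y ─ X ⊎ v ∈ X
      Y⊆ {v} v∈Y with v ∈? X
      ... | yes v∈X = inj₂ v∈X
      ... | no  v∉X = inj₁ (∪⁺ʳ D (Y ─ X) (─⁺ v∈Y v∉X))

    -- A whole bag is moved into R only when it holds a new mark or when two marked
    -- branches meet, so the number of selected bags is linear in the number of
    -- marks while every piece touches at most two of them.
    SizedSplit : Sub V → List V → Set
    SizedSplit D Y = ∃[ S ] (Untouched {D} {Y} S ⊎ Bounded S)

    private
      unit : ℕ
      unit = (w + w) + (w + w)

    sized-∪ : ∀ {D E Y} → Branch Y D → Branch Y E → (∀ {v} → v ∊ D → ¬ v ∊ E) → length Y ≤ w →
              SizedSplit D Y → SizedSplit E Y → SizedSplit (D ∪ E) Y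
    sized-∪ {D} {E} b e disjoint Y≤w (S , inj₁ u@(R≡[] , _)) (S′ , size′) =
      split-∪-untouchedˡ b e disjoint S S′ u , [ inj₁ ∘ both , inj₂ ∘ right ]′ size′
      where
      both : Untouched S′ → _ × _
      both (R′≡[] , Z′≡[]) = cong₂ _++_ R≡[] R′≡[] , Z′≡[]

      right : Bounded S′ → _
      right size = ≤-trans (≤-reflexive (cong (λ R → length (R ++ Split.R S′) + (w + w)) R≡[]))
        (≤-trans size (*-monoˡ-≤ unit (≤-trans (m≤n+m _ (count D W)) (count-∪ D E W disjoint))))
    sized-∪ {D} {E} b e disjoint Y≤w (S , inj₂ size) (S′ , inj₁ u@(R′≡[] , _)) =
      split-∪-untouchedʳ b e disjoint S S′ u ,
      inj₂ (≤-trans (≤-reflexive (cong (_+ (w + w)) (trans (length-++ (Split.R S))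
        (trans (cong (length (Split.R S) +_) (cong length R′≡[])) (+-identityʳ _)))))
        (≤-trans size (*-monoˡ-≤ unit (≤-trans (m≤m+n _ (count E W)) (count-∪ D E W disjoint)))))
    -- Both branches hold marks. The union of their separators could have 2w vertices, so both are
    -- first closed off at Y.
    sized-∪ {D} {E} {Y} b e disjoint Y≤w (S , inj₂ size) (S′ , inj₂ size′) =
      split-∪-covered b e disjoint S.closeOff S′.closeOff S.closeOff-covers S′.closeOff-covers Y≤w ∈-++⁺ˡ ,
      inj₂ bounded
      where
      module S  = Closing b Y≤w S
      module S′ = Closing e Y≤w S′
      open ≤-Reasoning
      r₁ = length (Split.R S)
      r₂ = length (Split.R S′)

      bounded : length ((Y ++ Split.R S) ++ (Y ++ Split.R S′)) + (w + w) ≤ count (D ∪ E) W * unit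
      bounded = begin
        length ((Y ++ Split.R S) ++ (Y ++ Split.R S′)) + (w + w)
          ≡⟨ cong (_+ (w + w)) (trans (length-++ (Y ++ Split.R S)) (cong₂ _+_ (length-++ Y) (length-++ Y))) ⟩
        ((length Y + r₁) + (length Y + r₂)) + (w + w)
          ≤⟨ +-monoˡ-≤ (w + w) (+-mono-≤ (+-monoˡ-≤ r₁ Y≤w) (+-monoˡ-≤ r₂ Y≤w)) ⟩
        ((w + r₁) + (w + r₂)) + (w + w)
          ≡⟨ solve 3 (λ w a b → ((w :+ a) :+ (w :+ b)) :+ (w :+ w) := (a :+ (w :+ w)) :+ (b :+ (w :+ w))) refl w r₁ r₂ ⟩
        (r₁ + (w + w)) + (r₂ + (w + w))
          ≤⟨ +-mono-≤ size size′ ⟩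
        count D W * unit + count E W * unit
          ≡⟨ *-distribʳ-+ unit (count D W) (count E W) ⟨
        (count D W + count E W) * unit
          ≤⟨ *-monoˡ-≤ unit (count-∪ D E W disjoint) ⟩
        count (D ∪ E) W * unit ∎

    sized-up : ∀ {X Y D} → Branch Y D → length Y ≤ w → SizedSplit D Y → SizedSplit (D ∪ Y ─ X) X
    sized-up {X} {Y} {D} b Y≤w (S , size) with any? (_∊? Y ─ X) W
    ... | no none = split-up S (λ v∈W v∊ → ⊥-elim (none (lose v∈W v∊))) ,
                    [ inj₁ , (λ size → inj₂ (≤-trans size
                        (*-monoˡ-≤ unit (≤-trans (m≤m+n (count D W) _) (count-∪ D (Y ─ X) W disjoint))))) ]′ size
      where
      disjoint : ∀ {v} → v ∊ D → ¬ v ∊ Y ─ X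
      disjoint v∊D v∊ = branch-avoids b v∊D (proj₁ (─⁻ v∊))
    -- A new mark lies in the bag; closing off moves all of Y, and with it the mark, into R. The
    -- mark pays for the bag and, if the branch was untouched, for the reserve.
    ... | yes some = split-up closeOff (λ _ v∊ → ∈-++⁺ˡ (proj₁ (─⁻ v∊))) , inj₂ bounded
      where
      open Closing b Y≤w S
      open ≤-Reasoning
      k = length (Split.R S)

      disjoint : ∀ {v} → v ∊ D → ¬ v ∊ Y ─ X
      disjoint v∊D v∊ = branch-avoids b v∊D (proj₁ (─⁻ v∊))

      old : Untouched S ⊎ Bounded S → (w + k) + (w + w) ≤ count D W * unit + unit
      old (inj₁ (R≡[] , _)) = begin
        (w + k) + (w + w)        ≡⟨ cong (λ R → (w + length R) + (w + w)) R≡[] ⟩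
        (w + 0) + (w + w)        ≤⟨ +-monoˡ-≤ (w + w) (+-monoʳ-≤ w z≤n) ⟩
        unit                     ≤⟨ m≤n+m unit (count D W * unit) ⟩
        count D W * unit + unit  ∎
      old (inj₂ size) = begin
        (w + k) + (w + w)        ≡⟨ solve 2 (λ w k → (w :+ k) :+ (w :+ w) := (k :+ (w :+ w)) :+ w) refl w k ⟩
        (k + (w + w)) + w        ≤⟨ +-mono-≤ size (≤-trans (m≤m+n w w) (m≤m+n (w + w) (w + w))) ⟩
        count D W * unit + unit  ∎

      bounded : length (Y ++ Split.R S) + (w + w) ≤ count (D ∪ Y ─ X) W * unit
      bounded = begin
        length (Y ++ Split.R S) + (w + w)  ≡⟨ cong (_+ (w + w)) (length-++ Y) ⟩
        (length Y + k) + (w + w)           ≤⟨ +-monoˡ-≤ (w + w) (+-monoˡ-≤ k Y≤w) ⟩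
        (w + k) + (w + w)                  ≤⟨ old size ⟩
        count D W * unit + unit            ≡⟨ +-comm _ unit ⟩
        suc (count D W) * unit             ≡⟨ cong (_* unit) (+-comm 1 (count D W)) ⟩
        (count D W + 1) * unit             ≤⟨ *-monoˡ-≤ unit (+-monoʳ-≤ (count D W) (count>0 (Y ─ X) some)) ⟩
        (count D W + count (Y ─ X) W) * unit ≤⟨ *-monoˡ-≤ unit (count-∪ D (Y ─ X) W disjoint) ⟩
        count (D ∪ Y ─ X) W * unit ∎

    split : ∀ {Y D} → Branch Y D → length Y ≤ w → SizedSplit D Y
    split nil _ = split-∅ , inj₁ (refl , refl)
    split (join b e disjoint) Y≤w = sized-∪ b e disjoint Y≤w (split b Y≤w) (split e Y≤w)
    split (up b Y≤w _ _ _) _ = sized-up b Y≤w (split b Y≤w)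

  length-concatMap-nbrs : ∀ Z → length (concatMap nbrs Z) ≤ length Z * Δ
  length-concatMap-nbrs []      = z≤n
  length-concatMap-nbrs (z ∷ Z) = ≤-trans (≤-reflexive (length-++ (nbrs z))) (+-mono-≤ (nbrs≤Δ z) (length-concatMap-nbrs Z))

  record Partition (H : Sub V) (W : List V) (c : Bool) : Set where
    field
      coloured : Coloured (radiusBound Δ w) H H c
    open Coloured coloured public
    field
      marked : ∀ {v} → v ∈ W → v ∊ H → colour v ≡ c

  module _ {D : Sub V} (b : Branch [] D) (B⊆D : ∀ {v} → v ∊ B → v ∊ D) where

    -- R receives c and its clusters are bounded because R is small. The neighbours of a piece in
    -- the rest of H lie in a set Z of at most 2w vertices; marking all neighbours of Z with the
    -- other colour in the recursive call keeps clusters from running between R and the piece.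
    partition-step : ∀ H → (∀ {v} → v ∊ H → v ∊ B) → ∀ W → length W ≤ markBound Δ w → ∀ c →
      (∀ P → (∀ {v} → v ∊ P → v ∊ H × v ∉ W) → ∀ W′ → length W′ ≤ markBound Δ w → Partition P W′ (not c)) →
      Partition H W c
    partition-step H H⊆B W W≤ c rec = record
      { coloured = record
        { colour = colour ; rep = rep ; mono = mono ; near = near
        ; boundary = λ v∊H u∊H u∉H _ → ⊥-elim (u∉H u∊H) }
      ; marked = λ {v} v∈W v∊H → colour-R (marks v∈W (B⊆D (H⊆B v∊H)))
      }
      where
      colourPiece : (P : Sub V) (Z : List V) → (∀ {v} → v ∊ P → v ∊ H × v ∉ W) → length Z ≤ w + w →
                    (∀ {h u} → h ∊ P → u ∊ H → Adj h u → u ∊ P ⊎ u ∈ Z) → Coloured (radiusBound Δ w) P H (not c)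
      colourPiece P Z P⊆ Z≤ closed = record
        { colour = Q.colour ; rep = Q.rep ; mono = Q.mono ; near = Q.near
        ; boundary = λ {u} {v} v∊P u∊H u∉P uv →
            [ ⊥-elim ∘ u∉P , (λ u∈Z → Q.marked (∈-concatMap⁺ nbrs (Any.map (λ { refl → ∈-nbrs uv }) u∈Z)) v∊P) ]′
              (closed v∊P u∊H (Asym uv)) }
        where
        module Q = Partition (rec P P⊆ (concatMap nbrs Z)
          (≤-trans (length-concatMap-nbrs Z) (≤-trans (*-monoˡ-≤ Δ Z≤) (n≤1+n _))))

      open Splitting H H⊆B W (radiusBound Δ w) (not c) colourPiece

      S₀ : SizedSplit D []
      S₀ = split b z≤n

      R-bound : length (Split.R (proj₁ S₀)) ≤ markBound Δ w * ((w + w) + (w + w))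
      R-bound with proj₂ S₀
      ... | inj₁ (R≡[] , _) = subst (λ R → length R ≤ _) (sym R≡[]) z≤n
      ... | inj₂ size = ≤-trans (m≤m+n _ (w + w)) (≤-trans size (*-monoˡ-≤ _ (≤-trans (count≤length D W) W≤)))

      open Closing b z≤n (proj₁ S₀) using (closeOff; closeOff-covers)
      open Split closeOff
      module K = Coloured coloured

      colour : V → Bool
      colour v = if ⌊ v ∈? R ⌋ then c else K.colour v

      rep : V → V
      rep v = if ⌊ v ∈? R ⌋ then centre R v else K.rep v

      colour-R : ∀ {v} → v ∈ R → colour v ≡ c
      colour-R {v} v∈R with v ∈? R
      ... | yes _ = refl
      ... | no v∉R = ⊥-elim (v∉R v∈R)

      inK : ∀ {v} → v ∊ H → v ∉ R → v ∊ K
      inK v∊H v∉R = [ ⊥-elim ∘ v∉R , (λ v∊K → v∊K) ]′ (closeOff-covers (B⊆D (H⊆B v∊H)) v∊H)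

      mono : ∀ {u v} → u ∊ H → v ∊ H → Adj u v → colour u ≡ colour v → rep u ≡ rep v
      mono {u} {v} u∊H v∊H uv eq with u ∈? R | v ∈? R
      ... | yes u∈R | yes v∈R = centre-adj R u∈R v∈R uv
      ... | yes u∈R | no  v∉R = ⊥-elim (not-¬ (trans (sym (K.boundary (inK v∊H v∉R) u∊H (λ u∊K → K∩R u∊K u∈R) uv)) (sym eq)) refl)
      ... | no  u∉R | yes v∈R = ⊥-elim (not-¬ (trans (sym (K.boundary (inK u∊H u∉R) v∊H (λ v∊K → K∩R v∊K v∈R) (Asym uv))) eq) refl)
      ... | no  u∉R | no  v∉R = K.mono (inK u∊H u∉R) (inK v∊H v∉R) uv eq

      near : ∀ {v} → v ∊ H → Near (radiusBound Δ w) (rep v) v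
      near {v} v∊H with v ∈? R
      ... | yes _  = near-mono (radius≤bound Δ w R-bound) (centre-near R v)
      ... | no v∉R = K.near (inK v∊H v∉R)

    -- The recursion is on a list containing H: a mark inside H goes into R, so it is missing from
    -- every piece.
    partition : ∀ k L H → (∀ {v} → v ∊ H → v ∊ B) → (∀ {v} → v ∊ H → v ∈ L) → length L ≤ k →
                ∀ W → length W ≤ markBound Δ w → ∀ c → Partition H W c
    partition-meeting : ∀ k L H → (∀ {v} → v ∊ H → v ∊ B) → (∀ {v} → v ∊ H → v ∈ L) → length L ≤ k →
                        ∀ W → length W ≤ markBound Δ w → ∀ c → Any (_∊ H) W → Partition H W c

    partition k L H H⊆B H⊆L L≤k W W≤ c with any? (_∊? H) W | any? (_∊? H) L
    ... | yes meets | _ = partition-meeting k L H H⊆B H⊆L L≤k W W≤ c meets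
    -- Without a mark in H an arbitrary vertex is marked to keep the recursion going; the successor
    -- in `markBound` leaves room for it.
    ... | no misses | yes some with x , _ , x∊H ← find some = record
      { coloured = Partition.coloured (partition-meeting k L H H⊆B H⊆L L≤k (x ∷ []) (s≤s z≤n) c (here x∊H))
      ; marked   = λ v∈W v∊H → ⊥-elim (misses (lose v∈W v∊H)) }
    ... | no misses | no none = record
      { coloured = record
        { colour = λ _ → c ; rep = λ v → v
        ; mono = λ u∊H _ _ _ → ⊥-elim (empty u∊H)
        ; near = ⊥-elim ∘ empty
        ; boundary = λ v∊H _ _ _ → ⊥-elim (empty v∊H) }
      ; marked = λ _ _ → refl }
      where
      empty : ∀ {v} → ¬ v ∊ H
      empty v∊H = none (lose (H⊆L v∊H) v∊H)

    partition-meeting zero L H H⊆B H⊆L L≤k W W≤ c meets with _ , _ , x∊H ← find meets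
      with _ ∷ _ ← L | () ← L≤k | here refl ← H⊆L x∊H
    partition-meeting (suc k) L H H⊆B H⊆L L≤k W W≤ c meets with x , x∈W , x∊H ← find meets =
      partition-step H H⊆B W W≤ c λ P P⊆ W′ W′≤ →
        partition k (filter (λ v → ¬? (v ≟ x)) L) P (H⊆B ∘ proj₁ ∘ P⊆)
          (λ v∊P → ∈-filter⁺ _ (H⊆L (proj₁ (P⊆ v∊P))) λ { refl → proj₂ (P⊆ v∊P) x∈W })
          (s≤s⁻¹ (≤-trans (filter-notAll _ L (Any.map (λ { refl x≢x → x≢x refl }) (H⊆L x∊H))) L≤k)) W′ W′≤ (not c)

-- The Kuhn triangulation modulo 2

sum : ℕ → (ℕ → Bool) → Bool
sum zero    f = false
sum (suc n) f = sum n f xor f n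

sum-cong : ∀ n {f g : ℕ → Bool} → (∀ {i} → i < n → f i ≡ g i) → sum n f ≡ sum n g
sum-cong zero    _  = refl
sum-cong (suc n) eq = cong₂ _xor_ (sum-cong n (λ i<n → eq (m≤n⇒m≤1+n i<n))) (eq ≤-refl)

sum-false : ∀ n → sum n (λ _ → false) ≡ false
sum-false zero    = refl
sum-false (suc n) = trans (xor-identityʳ _) (sum-false n)

interchange : ∀ a b c d → (a xor b) xor (c xor d) ≡ (a xor c) xor (b xor d)
interchange = xor-solve 4 (λ a b c d → (a :⊕ b) :⊕ (c :⊕ d) ⊜ (a :⊕ c) :⊕ (b :⊕ d)) refl

sum-xor : ∀ n (f g : ℕ → Bool) → sum n (λ i → f i xor g i) ≡ sum n f xor sum n g
sum-xor zero    f g = refl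
sum-xor (suc n) f g = trans (cong (_xor (f n xor g n)) (sum-xor n f g)) (interchange (sum n f) (sum n g) (f n) (g n))

telescope : ∀ n (f : ℕ → Bool) → sum n (λ i → f i xor f (suc i)) ≡ f 0 xor f n
telescope zero    f = sym (xor-same (f 0))
telescope (suc n) f = trans (cong (_xor (f n xor f (suc n))) (telescope n f))
  (xor-solve 3 (λ a b c → (a :⊕ b) :⊕ (b :⊕ c) ⊜ a :⊕ c) refl
    (f 0) (f n) (f (suc n)))

-- The constructors are instances so that a single term supplies all 36 adjacencies in the six
-- tetrahedra of a cube.
data _⊑_ : ℕ → ℕ → Set where
  instance
    stay : ∀ {x} → x ⊑ x
    rise : ∀ {x} → x ⊑ suc x

module Kuhn {V : Set} where

  -- `edges` and `faces` are the simplicial coboundaries modulo 2.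
  edges : (V → V → Bool) → V → V → V → Bool
  edges h p q r = h q r xor (h p r xor h p q)

  faces : (V → V → V → Bool) → V → V → V → V → Bool
  faces g p q r s = (g q r s xor g p r s) xor (g p q s xor g p q r)

  square : (V → V → V → Bool) → V → V → V → V → Bool
  square g o a b m = g o a m xor g o b m

  -- The six tetrahedra o < · < · < m of the Kuhn triangulation of a unit cube.
  cube : (V → V → V → V → Bool) → V → V → V → V → V → V → V → V → Bool
  cube f o a b c ab ac bc m =
    ((f o a ab m xor f o a ac m) xor (f o b ab m xor f o b bc m)) xor (f o c ac m xor f o c bc m)

  cube-xor : ∀ f f′ o a b c ab ac bc m → cube (λ p q r s → f p q r s xor f′ p q r s) o a b c ab ac bc m ≡
    cube f o a b c ab ac bc m xor cube f′ o a b c ab ac bc m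
  cube-xor f f′ o a b c ab ac bc m =
    xor-solve 12 (λ a b c d e g a′ b′ c′ d′ e′ g′ →
      (((a :⊕ a′) :⊕ (b :⊕ b′)) :⊕ ((c :⊕ c′) :⊕ (d :⊕ d′))) :⊕ ((e :⊕ e′) :⊕ (g :⊕ g′)) ⊜
      (((a :⊕ b) :⊕ (c :⊕ d)) :⊕ (e :⊕ g)) :⊕ (((a′ :⊕ b′) :⊕ (c′ :⊕ d′)) :⊕ (e′ :⊕ g′))) refl
      (f o a ab m) (f o a ac m) (f o b ab m) (f o b bc m) (f o c ac m) (f o c bc m)
      (f′ o a ab m) (f′ o a ac m) (f′ o b ab m) (f′ o b bc m) (f′ o c ac m) (f′ o c bc m)

  square-edges : ∀ h o a b m → square (edges h) o a b m ≡ (h o a xor h b m) xor (h o b xor h a m)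
  square-edges h o a b m =
    xor-solve 5 (λ am om oa bm ob → (am :⊕ (om :⊕ oa)) :⊕ (bm :⊕ (om :⊕ ob)) ⊜ (oa :⊕ bm) :⊕ (ob :⊕ am)) refl
      (h a m) (h o m) (h o a) (h b m) (h o b)

  -- The six triangles on the long diagonal from o to m lie in two tetrahedra each and cancel; the
  -- other twelve triangulate the surface.
  cube-faces : ∀ g o a b c ab ac bc m → cube (faces g) o a b c ab ac bc m ≡
    ((square g o b c bc xor square g a ab ac m) xor (square g o a c ac xor square g b ab bc m))
      xor (square g o a b ab xor square g c ac bc m)
  cube-faces g o a b c ab ac bc m =
    xor-solve 18 (λ aabm aacm babm bbcm cacm cbcm oam obm ocm oabm oacm obcm oaab oaac obab obbc ocac ocbc →
      ((((aabm :⊕ oabm) :⊕ (oam :⊕ oaab)) :⊕ ((aacm :⊕ oacm) :⊕ (oam :⊕ oaac)))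
        :⊕ (((babm :⊕ oabm) :⊕ (obm :⊕ obab)) :⊕ ((bbcm :⊕ obcm) :⊕ (obm :⊕ obbc))))
        :⊕ (((cacm :⊕ oacm) :⊕ (ocm :⊕ ocac)) :⊕ ((cbcm :⊕ obcm) :⊕ (ocm :⊕ ocbc)))
      ⊜ (((obbc :⊕ ocbc) :⊕ (aabm :⊕ aacm)) :⊕ ((oaac :⊕ ocac) :⊕ (babm :⊕ bbcm)))
        :⊕ ((oaab :⊕ obab) :⊕ (cacm :⊕ cbcm)))
      refl
      (g a ab m) (g a ac m) (g b ab m) (g b bc m) (g c ac m) (g c bc m)
      (g o a m) (g o b m) (g o c m) (g o ab m) (g o ac m) (g o bc m)
      (g o a ab) (g o a ac) (g o b ab) (g o b bc) (g o c ac) (g o c bc)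

  module Box (N : ℕ) (pt : ℕ → ℕ → ℕ → V) where

    cubeAt : (V → V → V → V → Bool) → ℕ → ℕ → ℕ → Bool
    cubeAt f x y z = cube f (pt x y z) (pt (suc x) y z) (pt x (suc y) z) (pt x y (suc z))
      (pt (suc x) (suc y) z) (pt (suc x) y (suc z)) (pt x (suc y) (suc z)) (pt (suc x) (suc y) (suc z))

    xSquare ySquare zSquare : (V → V → V → Bool) → ℕ → ℕ → ℕ → Bool
    xSquare g x y z = square g (pt x y z) (pt x (suc y) z) (pt x y (suc z)) (pt x (suc y) (suc z))
    ySquare g x y z = square g (pt x y z) (pt (suc x) y z) (pt x y (suc z)) (pt (suc x) y (suc z))
    zSquare g x y z = square g (pt x y z) (pt (suc x) y z) (pt x (suc y) z) (pt (suc x) (suc y) z)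

    total : (V → V → V → V → Bool) → Bool
    total f = sum N λ x → sum N λ y → sum N λ z → cubeAt f x y z

    xFace yFace zFace : (V → V → V → Bool) → ℕ → Bool
    xFace g x = sum N λ y → sum N λ z → xSquare g x y z
    yFace g y = sum N λ x → sum N λ z → ySquare g x y z
    zFace g z = sum N λ x → sum N λ y → zSquare g x y z

    -- Squares shared by neighbouring cubes cancel, by telescoping in each of the three directions.
    stokes : ∀ g → total (faces g) ≡
      ((xFace g 0 xor xFace g N) xor (yFace g 0 xor yFace g N)) xor (zFace g 0 xor zFace g N)
    stokes g = trans (sum-cong N λ {x} _ → slice x) (trans (sum-xor N _ _) (cong₂ _xor_ (trans (sum-xor N _ _)
      (cong₂ _xor_ (telescope N (xFace g)) (sum-xor N _ _))) (sum-xor N _ _)))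
      where
      column : ∀ x y → sum N (λ z → cubeAt (faces g) x y z) ≡
        ((sum N (xSquare g x y) xor sum N (xSquare g (suc x) y)) xor (sum N (ySquare g x y) xor sum N (ySquare g x (suc y))))
          xor (zSquare g x y 0 xor zSquare g x y N)
      column x y = trans (sum-cong N (λ {z} _ → cube-faces g _ _ _ _ _ _ _ _))
        (trans (sum-xor N _ _) (cong₂ _xor_ (trans (sum-xor N _ _) (cong₂ _xor_ (sum-xor N _ _) (sum-xor N _ _)))
          (telescope N (zSquare g x y))))

      slice : ∀ x → sum N (λ y → sum N λ z → cubeAt (faces g) x y z) ≡
        ((xFace g x xor xFace g (suc x)) xor (sum N (ySquare g x 0) xor sum N (ySquare g x N)))
          xor (sum N (λ y → zSquare g x y 0) xor sum N (λ y → zSquare g x y N))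
      slice x = trans (sum-cong N (λ {y} _ → column x y))
        (trans (sum-xor N _ _) (cong₂ _xor_ (trans (sum-xor N _ _) (cong₂ _xor_ (sum-xor N _ _)
          (telescope N (λ y → sum N (ySquare g x y))))) (sum-xor N _ _)))

    stokes² : ∀ h x → xFace (edges h) x ≡
      (sum N (λ y → h (pt x y 0) (pt x (suc y) 0)) xor sum N (λ y → h (pt x y N) (pt x (suc y) N)))
        xor (sum N (λ z → h (pt x 0 z) (pt x 0 (suc z))) xor sum N (λ z → h (pt x N z) (pt x N (suc z))))
    stokes² h x = trans (sum-cong N λ {y} _ → row y) (trans (sum-xor N _ _) (cong₂ _xor_ (sum-xor N _ _)
      (telescope N (λ y → sum N λ z → h (pt x y z) (pt x y (suc z))))))
      where
      row : ∀ y → sum N (xSquare (edges h) x y) ≡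
        (h (pt x y 0) (pt x (suc y) 0) xor h (pt x y N) (pt x (suc y) N))
          xor (sum N (λ z → h (pt x y z) (pt x y (suc z))) xor sum N (λ z → h (pt x (suc y) z) (pt x (suc y) (suc z))))
      row y = trans (sum-cong N (λ {z} _ → square-edges h (pt x y z) (pt x (suc y) z) (pt x y (suc z)) (pt x (suc y) (suc z))))
        (trans (sum-xor N _ _) (cong₂ _xor_ (telescope N (λ z → h (pt x y z) (pt x (suc y) z))) (sum-xor N _ _)))

    module _ {g g′ : V → V → V → Bool} (P : V → Set)
      (eq : ∀ {p q r} → P p → P q → P r → g p q r ≡ g′ p q r) where

      square-cong : ∀ {o a b m} → P o → P a → P b → P m → square g o a b m ≡ square g′ o a b m
      square-cong o a b m = cong₂ _xor_ (eq o a m) (eq o b m)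

      xFace-cong : ∀ {x} → (∀ {y z} → y ≤ N → z ≤ N → P (pt x y z)) → xFace g x ≡ xFace g′ x
      xFace-cong on = sum-cong N λ y<N → sum-cong N λ z<N →
        square-cong (on (<⇒≤ y<N) (<⇒≤ z<N)) (on y<N (<⇒≤ z<N)) (on (<⇒≤ y<N) z<N) (on y<N z<N)

      yFace-cong : ∀ {y} → (∀ {x z} → x ≤ N → z ≤ N → P (pt x y z)) → yFace g y ≡ yFace g′ y
      yFace-cong on = sum-cong N λ x<N → sum-cong N λ z<N →
        square-cong (on (<⇒≤ x<N) (<⇒≤ z<N)) (on x<N (<⇒≤ z<N)) (on (<⇒≤ x<N) z<N) (on x<N z<N)

      zFace-cong : ∀ {z} → (∀ {x y} → x ≤ N → y ≤ N → P (pt x y z)) → zFace g z ≡ zFace g′ z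
      zFace-cong on = sum-cong N λ x<N → sum-cong N λ y<N →
        square-cong (on (<⇒≤ x<N) (<⇒≤ y<N)) (on x<N (<⇒≤ y<N)) (on (<⇒≤ x<N) y<N) (on x<N y<N)

    sum²-false : sum N (λ _ → sum N λ _ → false) ≡ false
    sum²-false = trans (sum-cong N (λ _ → sum-false N)) (sum-false N)

    total-xor : ∀ f f′ → total (λ p q r s → f p q r s xor f′ p q r s) ≡ total f xor total f′
    total-xor f f′ = trans (sum-cong N λ {x} _ → trans (sum-cong N λ {y} _ →
        trans (sum-cong N λ {z} _ → cubeAt-xor x y z) (sum-xor N _ _)) (sum-xor N _ _)) (sum-xor N _ _)
      where
      cubeAt-xor : ∀ x y z → cubeAt (λ p q r s → f p q r s xor f′ p q r s) x y z ≡ cubeAt f x y z xor cubeAt f′ x y z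
      cubeAt-xor x y z = cube-xor f f′ (pt x y z) (pt (suc x) y z) (pt x (suc y) z) (pt x y (suc z))
        (pt (suc x) (suc y) z) (pt (suc x) y (suc z)) (pt x (suc y) (suc z)) (pt (suc x) (suc y) (suc z))

    total-false : total (λ _ _ _ _ → false) ≡ false
    total-false = trans (sum-cong N λ _ → sum²-false) (sum-false N)

    module Congruence (Adj : V → V → Set)
      (pt-adj : ∀ {x y z x′ y′ z′} → ⦃ x ⊑ x′ ⦄ → ⦃ y ⊑ y′ ⦄ → ⦃ z ⊑ z′ ⦄ →
                ⦃ x′ ≤ N ⦄ → ⦃ y′ ≤ N ⦄ → ⦃ z′ ≤ N ⦄ → Adj (pt x y z) (pt x′ y′ z′)) where

      data Tetrahedron : V → V → V → V → Set where
        tet : ∀ {p q r s} → Adj p q → Adj p r → Adj p s → Adj q r → Adj q s → Adj r s → Tetrahedron p q r s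

      total-cong : ∀ {f f′} → (∀ {p q r s} → Tetrahedron p q r s → f p q r s ≡ f′ p q r s) → total f ≡ total f′
      total-cong {f} {f′} eq = sum-cong N λ x<N → sum-cong N λ y<N → sum-cong N λ z<N → at x<N y<N z<N
        where
        at : ∀ {x y z} → x < N → y < N → z < N → cubeAt f x y z ≡ cubeAt f′ x y z
        at x<N y<N z<N =
          cong₂ _xor_
            (cong₂ _xor_
              (cong₂ _xor_ (eq (tet pt-adj pt-adj pt-adj pt-adj pt-adj pt-adj))
                           (eq (tet pt-adj pt-adj pt-adj pt-adj pt-adj pt-adj)))
              (cong₂ _xor_ (eq (tet pt-adj pt-adj pt-adj pt-adj pt-adj pt-adj))
                           (eq (tet pt-adj pt-adj pt-adj pt-adj pt-adj pt-adj))))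
            (cong₂ _xor_ (eq (tet pt-adj pt-adj pt-adj pt-adj pt-adj pt-adj))
                         (eq (tet pt-adj pt-adj pt-adj pt-adj pt-adj pt-adj)))
          where
          instance
            _ = x<N
            _ = y<N
            _ = z<N

            _ = <⇒≤ x<N
            _ = <⇒≤ y<N
            _ = <⇒≤ z<N

-- Four labels

Label : Set
Label = Fin 4

full? : ∀ (a b c d : Label) → Dec (∀ l → l ≡ a ⊎ l ≡ b ⊎ l ≡ c ⊎ l ≡ d)
full? a b c d = Fin.all? λ l → (l Fin.≟ a) ⊎-dec (l Fin.≟ b) ⊎-dec (l Fin.≟ c) ⊎-dec (l Fin.≟ d)

opaque
  -- Doors are expressed by `full` as well: `full e a b c` says that a, b, c are
  -- the three labels other than e.
  full : Label → Label → Label → Label → Bool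
  full a b c d = does (full? a b c d)

-- The edges with labels 2 and 3, in either order.
arc : Label → Label → Bool
arc a b = full 0F 1F a b

opaque
  unfolding full

  -- Sperner's observation, for doors with any omitted label e: a rainbow tetrahedron has exactly
  -- one door, any other has none or two.
  full-faces : ∀ e a b c d → full a b c d ≡ (full e b c d xor full e a c d) xor (full e a b d xor full e a b c)
  full-faces = from-yes (Fin.all? λ e → Fin.all? λ a → Fin.all? λ b → Fin.all? λ c → Fin.all? λ d →
    full a b c d ≟ᵇ ((full e b c d xor full e a c d) xor (full e a b d xor full e a b c)))

  -- The same observation one dimension lower, on a face that lacks the label 0.
  door-arcs : ∀ a b c → a ≢ 0F → b ≢ 0F → c ≢ 0F → full 0F a b c ≡ arc b c xor (arc a c xor arc a b)
  door-arcs = from-yes (Fin.all? λ a → Fin.all? λ b → Fin.all? λ c → ¬? (a Fin.≟ 0F) →-dec ¬? (b Fin.≟ 0F) →-dec ¬? (c Fin.≟ 0F) →-dec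
    full 0F a b c ≟ᵇ (arc b c xor (arc a c xor arc a b)))

  arc-ends : ∀ a b → a ≢ 0F → a ≢ 1F → b ≢ 0F → b ≢ 1F → arc a b ≡ does (a Fin.≟ 3F) xor does (b Fin.≟ 3F)
  arc-ends = from-yes (Fin.all? λ a → Fin.all? λ b → ¬? (a Fin.≟ 0F) →-dec ¬? (a Fin.≟ 1F) →-dec
    ¬? (b Fin.≟ 0F) →-dec ¬? (b Fin.≟ 1F) →-dec
    arc a b ≟ᵇ (does (a Fin.≟ 3F) xor does (b Fin.≟ 3F)))

  full⁻ : ∀ {a b c d} → full a b c d ≡ true → ∀ l → l ≡ a ⊎ l ≡ b ⊎ l ≡ c ⊎ l ≡ d
  full⁻ {a} {b} {c} {d} eq with full? a b c d
  ... | yes p = p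
  ... | no ¬p = contradiction (trans (sym eq) (dec-false (full? a b c d) ¬p)) λ ()

  full-missing : ∀ l {a b c d} → l ≢ a → l ≢ b → l ≢ c → l ≢ d → full a b c d ≡ false
  full-missing l {a} {b} {c} {d} l≢a l≢b l≢c l≢d =
    dec-false (full? a b c d) λ p → [ l≢a , [ l≢b , [ l≢c , l≢d ]′ ]′ ]′ (p l)

  full-repeated : ∀ e a b c → a ≡ b ⊎ a ≡ c ⊎ b ≡ c → full e a b c ≡ false
  full-repeated = from-yes (Fin.all? λ e → Fin.all? λ a → Fin.all? λ b → Fin.all? λ c →
    ((a Fin.≟ b) ⊎-dec (a Fin.≟ c) ⊎-dec (b Fin.≟ c)) →-dec (full e a b c ≟ᵇ false))

-- Counting rainbow tetrahedra

module Parity {V : Set} (Adj : Rel V 0ℓ) (Arefl : ∀ {v} → Adj v v) (Asym : Symmetric Adj)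
  (co : V → Fin 3 → ℕ) (adj-co : ∀ {u v} → Adj u v → ∀ i → co u i ≤ suc (co v i))
  (N : ℕ) (pt : ℕ → ℕ → ℕ → V)
  (pt-x : ∀ {x y z} → x ≤ N → y ≤ N → z ≤ N → co (pt x y z) 0F ≡ x)
  (pt-y : ∀ {x y z} → x ≤ N → y ≤ N → z ≤ N → co (pt x y z) 1F ≡ y)
  (pt-z : ∀ {x y z} → x ≤ N → y ≤ N → z ≤ N → co (pt x y z) 2F ≡ z)
  (pt-adj : ∀ {x y z x′ y′ z′} → ⦃ x ⊑ x′ ⦄ → ⦃ y ⊑ y′ ⦄ → ⦃ z ⊑ z′ ⦄ →
            ⦃ x′ ≤ N ⦄ → ⦃ y′ ≤ N ⦄ → ⦃ z′ ≤ N ⦄ → Adj (pt x y z) (pt x′ y′ z′))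
  (r : ℕ) (pos : V → V)
  (pos-near : ∀ v i → co (pos v) i ≤ r + co v i × co v i ≤ r + co (pos v) i)
  (h : ℕ) (r<h : r < h) (h+r≤N : h + r ≤ N)
  where

  open Kuhn {V}
  open Box N pt
  open Congruence Adj pt-adj

  -- A margin that contraction cannot bridge: vertices on a face of the box stay on their side of
  -- the plane at c.
  record Inner (c : ℕ) : Set where
    constructor inner
    field
      above : r < c
      below : c + r ≤ N

  -- All four labels are seen only near (px , py , h); the labels 1, 2, 3 together
  -- only near the ray from there in direction +x, and 0, 2, 3 only near the ray in
  -- direction +y.
  labelAt : ℕ → ℕ → V → Label
  labelAt px py q with co q 0F <? px | co q 1F <? py | co q 2F <? h
  ... | yes _ | _     | _     = 0F
  ... | no  _ | yes _ | _     = 1F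
  ... | no  _ | no  _ | yes _ = 2F
  ... | no  _ | no  _ | no  _ = 3F

  opaque
    label : ℕ → ℕ → V → Label
    label px py v = labelAt px py (pos v)

  module _ {px py : ℕ} where
    opaque
      unfolding label

      label0⇒x< : ∀ v → label px py v ≡ 0F → co (pos v) 0F < px
      label0⇒x< v eq with co (pos v) 0F <? px | co (pos v) 1F <? py | co (pos v) 2F <? h
      ... | yes p | _     | _     = p
      label0⇒x< v () | no  _ | yes _ | _
      label0⇒x< v () | no  _ | no  _ | yes _
      label0⇒x< v () | no  _ | no  _ | no  _

      label≢0⇒x≥ : ∀ v → label px py v ≢ 0F → px ≤ co (pos v) 0F
      label≢0⇒x≥ v ≢0 with co (pos v) 0F <? px | co (pos v) 1F <? py | co (pos v) 2F <? h
      ... | yes _ | _     | _     = ⊥-elim (≢0 refl)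
      ... | no ¬p | _     | _     = ≮⇒≥ ¬p

      label1⇒y< : ∀ v → label px py v ≡ 1F → co (pos v) 1F < py
      label1⇒y< v eq with co (pos v) 0F <? px | co (pos v) 1F <? py | co (pos v) 2F <? h
      ... | no _ | yes p | _ = p
      label1⇒y< v () | yes _ | _     | _
      label1⇒y< v () | no  _ | no  _ | yes _
      label1⇒y< v () | no  _ | no  _ | no  _

      label≢0,1⇒y≥ : ∀ v → label px py v ≢ 0F → label px py v ≢ 1F → py ≤ co (pos v) 1F
      label≢0,1⇒y≥ v ≢0 ≢1 with co (pos v) 0F <? px | co (pos v) 1F <? py | co (pos v) 2F <? h
      ... | yes _ | _     | _ = ⊥-elim (≢0 refl)
      ... | no _  | yes _ | _ = ⊥-elim (≢1 refl)
      ... | no _  | no ¬p | _ = ≮⇒≥ ¬p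

      label2⇒z< : ∀ v → label px py v ≡ 2F → co (pos v) 2F < h
      label2⇒z< v eq with co (pos v) 0F <? px | co (pos v) 1F <? py | co (pos v) 2F <? h
      ... | no _ | no _ | yes p = p
      label2⇒z< v () | yes _ | _     | _
      label2⇒z< v () | no  _ | yes _ | _
      label2⇒z< v () | no  _ | no  _ | no  _

      label3⇒z≥ : ∀ v → label px py v ≡ 3F → h ≤ co (pos v) 2F
      label3⇒z≥ v eq with co (pos v) 0F <? px | co (pos v) 1F <? py | co (pos v) 2F <? h
      ... | no _ | no _ | no ¬p = ≮⇒≥ ¬p
      label3⇒z≥ v () | yes _ | _     | _
      label3⇒z≥ v () | no  _ | yes _ | _
      label3⇒z≥ v () | no  _ | no  _ | yes _

    label2⇒y≥ : ∀ v → label px py v ≡ 2F → py ≤ co (pos v) 1F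
    label2⇒y≥ v eq = label≢0,1⇒y≥ v (λ eq′ → contradiction (trans (sym eq) eq′) λ ()) (λ eq′ → contradiction (trans (sym eq) eq′) λ ())

    label2⇒x≥ : ∀ v → label px py v ≡ 2F → px ≤ co (pos v) 0F
    label2⇒x≥ v eq = label≢0⇒x≥ v (λ eq′ → contradiction (trans (sym eq) eq′) λ ())

    label3⇒x≥ : ∀ v → label px py v ≡ 3F → px ≤ co (pos v) 0F
    label3⇒x≥ v eq = label≢0⇒x≥ v (λ eq′ → contradiction (trans (sym eq) eq′) λ ())

    label3⇒y≥ : ∀ v → label px py v ≡ 3F → py ≤ co (pos v) 1F
    label3⇒y≥ v eq = label≢0,1⇒y≥ v (λ eq′ → contradiction (trans (sym eq) eq′) λ ()) (λ eq′ → contradiction (trans (sym eq) eq′) λ ())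

  low : ∀ {c i v} → r < c → co v i ≡ 0 → ¬ c ≤ co (pos v) i
  low {c} {i} {v} r<c eq c≤ = <⇒≱ r<c (≤-trans c≤
    (≤-trans (proj₁ (pos-near v i)) (≤-reflexive (trans (cong (r +_) eq) (+-identityʳ r)))))

  high : ∀ {c i v} → c + r ≤ N → co v i ≡ N → ¬ co (pos v) i < c
  high {c} {i} {v} c+r≤N eq <c = <⇒≱ <c (+-cancelʳ-≤ r c (co (pos v) i)
    (≤-trans c+r≤N (≤-trans (≤-reflexive (sym eq)) (≤-trans (proj₂ (pos-near v i)) (≤-reflexive (+-comm r _))))))

  module Faces {px py : ℕ} (Px : Inner px) (Py : Inner py) where
    open Inner

    x0⇒≢3 : ∀ {v} → co v 0F ≡ 0 → label px py v ≢ 3F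
    x0⇒≢3 {v} eq = low (Px .above) eq ∘ label3⇒x≥ v

    xN⇒≢0 : ∀ {v} → co v 0F ≡ N → label px py v ≢ 0F
    xN⇒≢0 {v} eq = high (Px .below) eq ∘ label0⇒x< v

    y0⇒≢3 : ∀ {v} → co v 1F ≡ 0 → label px py v ≢ 3F
    y0⇒≢3 {v} eq = low (Py .above) eq ∘ label3⇒y≥ v

    yN⇒≢1 : ∀ {v} → co v 1F ≡ N → label px py v ≢ 1F
    yN⇒≢1 {v} eq = high (Py .below) eq ∘ label1⇒y< v

    z0⇒≢3 : ∀ {v} → co v 2F ≡ 0 → label px py v ≢ 3F
    z0⇒≢3 {v} eq = low r<h eq ∘ label3⇒z≥ v

    zN⇒≢2 : ∀ {v} → co v 2F ≡ N → label px py v ≢ 2F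
    zN⇒≢2 {v} eq = high h+r≤N eq ∘ label2⇒z< v

  opaque
    unfolding label

    xN⇒label≡ : ∀ {px px′ py} → Inner px → Inner px′ → ∀ {v} → co v 0F ≡ N → label px py v ≡ label px′ py v
    xN⇒label≡ {px} {px′} {py} Px Px′ {v} eq with co (pos v) 0F <? px | co (pos v) 0F <? px′ | co (pos v) 1F <? py | co (pos v) 2F <? h
    ... | yes p | _     | _     | _     = ⊥-elim (high (Inner.below Px) eq p)
    ... | _     | yes p | _     | _     = ⊥-elim (high (Inner.below Px′) eq p)
    ... | no _  | no _  | yes _ | _     = refl
    ... | no _  | no _  | no _  | yes _ = refl
    ... | no _  | no _  | no _  | no _  = refl

    yN⇒label≡ : ∀ {px py py′} → Inner py → Inner py′ → ∀ {v} → co v 1F ≡ N → label px py v ≡ label px py′ v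
    yN⇒label≡ {px} {py} {py′} Py Py′ {v} eq with co (pos v) 0F <? px | co (pos v) 1F <? py | co (pos v) 1F <? py′ | co (pos v) 2F <? h
    ... | yes _ | _     | _     | _     = refl
    ... | no _  | yes p | _     | _     = ⊥-elim (high (Inner.below Py) eq p)
    ... | no _  | _     | yes p | _     = ⊥-elim (high (Inner.below Py′) eq p)
    ... | no _  | no _  | no _  | yes _ = refl
    ... | no _  | no _  | no _  | no _  = refl

  meets₃ : Sub V → V → V → V → Bool
  meets₃ P a b c = P a ∨ P b ∨ P c

  meets₄ : Sub V → V → V → V → V → Bool
  meets₄ P a b c d = P a ∨ P b ∨ P c ∨ P d

  rainbow : ℕ → ℕ → V → V → V → V → Bool
  rainbow px py a b c d = full (label px py a) (label px py b) (label px py c) (label px py d)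

  door : Label → ℕ → ℕ → V → V → V → Bool
  door e px py a b c = full e (label px py a) (label px py b) (label px py c)

  opaque
    count : ℕ → ℕ → Sub V → Bool
    count px py P = total λ a b c d → meets₄ P a b c d ∧ rainbow px py a b c d

  module _ (P : Sub V) {a b c d : V} where

    ∉⇒meets₃ : ¬ a ∊ P → ¬ b ∊ P → ¬ c ∊ P → meets₃ P a b c ≡ false
    ∉⇒meets₃ a∉ b∉ c∉ = cong₂ _∨_ (∉⇒false P a∉) (cong₂ _∨_ (∉⇒false P b∉) (∉⇒false P c∉))

    meets₃? : meets₃ P a b c ≡ true ⊎ (¬ a ∊ P × ¬ b ∊ P × ¬ c ∊ P)
    meets₃? with P a | P b | P c
    ... | true  | _     | _     = inj₁ refl
    ... | false | true  | _     = inj₁ refl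
    ... | false | false | true  = inj₁ refl
    ... | false | false | false = inj₂ ((λ ()) , (λ ()) , λ ())

    ∉⇒meets₄ : ¬ a ∊ P → ¬ b ∊ P → ¬ c ∊ P → ¬ d ∊ P → meets₄ P a b c d ≡ false
    ∉⇒meets₄ a∉ b∉ c∉ d∉ = cong₂ _∨_ (∉⇒false P a∉) (cong₂ _∨_ (∉⇒false P b∉) (cong₂ _∨_ (∉⇒false P c∉) (∉⇒false P d∉)))

    meets₄? : (meets₄ P a b c d ≡ true × (a ∊ P ⊎ b ∊ P ⊎ c ∊ P ⊎ d ∊ P))
              ⊎ (¬ a ∊ P × ¬ b ∊ P × ¬ c ∊ P × ¬ d ∊ P)
    meets₄? with P a | P b | P c | P d
    ... | true  | _     | _     | _     = inj₁ (refl , inj₁ _)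
    ... | false | true  | _     | _     = inj₁ (refl , inj₂ (inj₁ _))
    ... | false | false | true  | _     = inj₁ (refl , inj₂ (inj₂ (inj₁ _)))
    ... | false | false | false | true  = inj₁ (refl , inj₂ (inj₂ (inj₂ _)))
    ... | false | false | false | false = inj₂ ((λ ()) , (λ ()) , (λ ()) , λ ())

  module _ (e : Label) (px py : ℕ) (P : Sub V) where

    -- This makes the rainbow tetrahedra meeting P the coboundary of the doors meeting P: a face
    -- that misses P belongs to a tetrahedron meeting P only if its apex v is in P, and then it must
    -- not be a door.
    Sealed : Set
    Sealed = ∀ {v a b c} → v ∊ P → ¬ a ∊ P → ¬ b ∊ P → ¬ c ∊ P →
             Adj v a → Adj v b → Adj v c → Adj a b → Adj a c → Adj b c → door e px py a b c ≡ false

    doorIn : V → V → V → Bool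
    doorIn a b c = meets₃ P a b c ∧ door e px py a b c

    module _ (sealed : Sealed) where

      face : ∀ {v a b c} → (¬ a ∊ P → ¬ b ∊ P → ¬ c ∊ P → v ∊ P) → Adj v a → Adj v b → Adj v c →
             Adj a b → Adj a c → Adj b c → door e px py a b c ≡ doorIn a b c
      face {v} {a} {b} {c} apex va vb vc ab ac bc with meets₃? P {a} {b} {c} {v}
      ... | inj₁ eq = cong (_∧ door e px py a b c) (sym eq)
      ... | inj₂ (a∉ , b∉ , c∉) = trans (sealed (apex a∉ b∉ c∉) a∉ b∉ c∉ va vb vc ab ac bc)
        (cong (_∧ door e px py a b c) (sym (∉⇒meets₃ P {d = v} a∉ b∉ c∉)))

      rainbow-faces : ∀ {a b c d} → Tetrahedron a b c d →
                      meets₄ P a b c d ∧ rainbow px py a b c d ≡ faces doorIn a b c d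
      rainbow-faces {a} {b} {c} {d} (tet ab ac ad bc bd cd) with meets₄? P {a} {b} {c} {d}
      ... | inj₂ (a∉ , b∉ , c∉ , d∉) = trans (cong (_∧ rainbow px py a b c d) (∉⇒meets₄ P a∉ b∉ c∉ d∉))
        (sym (cong₂ _xor_ (cong₂ _xor_ (none b∉ c∉ d∉) (none a∉ c∉ d∉)) (cong₂ _xor_ (none a∉ b∉ d∉) (none a∉ b∉ c∉))))
        where
        none : ∀ {x y z} → ¬ x ∊ P → ¬ y ∊ P → ¬ z ∊ P → doorIn x y z ≡ false
        none {x} {y} {z} x∉ y∉ z∉ = cong (_∧ door e px py x y z) (∉⇒meets₃ P {d = x} x∉ y∉ z∉)
      ... | inj₁ (eq , some) = trans (cong (_∧ rainbow px py a b c d) eq)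
        (trans (full-faces e (label px py a) (label px py b) (label px py c) (label px py d))
          (cong₂ _xor_
            (cong₂ _xor_
              (face (λ b∉ c∉ d∉ → [ (λ p → p) , [ ⊥-elim ∘ b∉ , [ ⊥-elim ∘ c∉ , ⊥-elim ∘ d∉ ]′ ]′ ]′ some)
                ab ac ad bc bd cd)
              (face (λ a∉ c∉ d∉ → [ ⊥-elim ∘ a∉ , [ (λ p → p) , [ ⊥-elim ∘ c∉ , ⊥-elim ∘ d∉ ]′ ]′ ]′ some)
                (Asym ab) bc bd ac ad cd))
            (cong₂ _xor_
              (face (λ a∉ b∉ d∉ → [ ⊥-elim ∘ a∉ , [ ⊥-elim ∘ b∉ , [ (λ p → p) , ⊥-elim ∘ d∉ ]′ ]′ ]′ some)
                (Asym ac) (Asym bc) cd ab ad bd)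
              (face (λ a∉ b∉ c∉ → [ ⊥-elim ∘ a∉ , [ ⊥-elim ∘ b∉ , [ ⊥-elim ∘ c∉ , (λ p → p) ]′ ]′ ]′ some)
                (Asym ad) (Asym bd) (Asym cd) ab ac bc))))

      opaque
        unfolding count

        count-faces : count px py P ≡ total (faces doorIn)
        count-faces = total-cong rainbow-faces

  module _ {g : V → V → V → Bool} (Q : V → Set) (none : ∀ {a b c} → Q a → Q b → Q c → g a b c ≡ false) where

    xFace-false : ∀ {x} → (∀ {y z} → y ≤ N → z ≤ N → Q (pt x y z)) → xFace g x ≡ false
    xFace-false on = trans (xFace-cong Q none on) sum²-false

    yFace-false : ∀ {y} → (∀ {x z} → x ≤ N → z ≤ N → Q (pt x y z)) → yFace g y ≡ false
    yFace-false on = trans (yFace-cong Q none on) sum²-false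

    zFace-false : ∀ {z} → (∀ {x y} → x ≤ N → y ≤ N → Q (pt x y z)) → zFace g z ≡ false
    zFace-false on = trans (zFace-cong Q none on) sum²-false

  On : Fin 3 → ℕ → V → Set
  On i k v = co v i ≡ k

  module _ {px py : ℕ} (Px : Inner px) (Py : Inner py) (P : Sub V) where
    open Faces Px Py

    private
      missing : ∀ e l → l ≢ e → (Q : V → Set) → (∀ {v} → Q v → label px py v ≢ l) →
                ∀ {a b c} → Q a → Q b → Q c → doorIn e px py P a b c ≡ false
      missing e l l≢e Q ≢l {a} {b} {c} qa qb qc =
        trans (cong (meets₃ P a b c ∧_) (full-missing l l≢e (≢l qa ∘ sym) (≢l qb ∘ sym) (≢l qc ∘ sym))) (∧-zeroʳ _)

    doors-x0 : ∀ e → 3F ≢ e → xFace (doorIn e px py P) 0 ≡ false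
    doors-x0 e ≢e = xFace-false (On 0F 0) (missing e 3F ≢e _ x0⇒≢3) (pt-x z≤n)

    doors-y0 : ∀ e → 3F ≢ e → yFace (doorIn e px py P) 0 ≡ false
    doors-y0 e ≢e = yFace-false (On 1F 0) (missing e 3F ≢e _ y0⇒≢3) (λ x≤ → pt-y x≤ z≤n)

    doors-z0 : ∀ e → 3F ≢ e → zFace (doorIn e px py P) 0 ≡ false
    doors-z0 e ≢e = zFace-false (On 2F 0) (missing e 3F ≢e _ z0⇒≢3) (λ x≤ y≤ → pt-z x≤ y≤ z≤n)

    doors-zN : ∀ e → 2F ≢ e → zFace (doorIn e px py P) N ≡ false
    doors-zN e ≢e = zFace-false (On 2F N) (missing e 2F ≢e _ zN⇒≢2) (λ x≤ y≤ → pt-z x≤ y≤ ≤-refl)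

    -- These doors carry 1, 2 and 3, and each face of the box other than x = N lacks one of the
    -- three.
    count-xN : Sealed 0F px py P → count px py P ≡ xFace (doorIn 0F px py P) N
    count-xN sealed = trans (count-faces 0F px py P sealed) (trans (stokes g) (trans
      (cong₂ _xor_ (cong₂ _xor_ (cong (_xor xFace g N) (doors-x0 0F λ ()))
                                (cong₂ _xor_ (doors-y0 0F λ ()) doors-yN))
                   (cong₂ _xor_ (doors-z0 0F λ ()) (doors-zN 0F λ ())))
      (trans (xor-identityʳ _) (xor-identityʳ _))))
      where
      g = doorIn 0F px py P
      doors-yN : yFace g N ≡ false
      doors-yN = yFace-false (On 1F N) (missing 0F 1F (λ ()) _ yN⇒≢1) (λ x≤ → pt-y x≤ ≤-refl)

    count-yN : Sealed 1F px py P → count px py P ≡ yFace (doorIn 1F px py P) N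
    count-yN sealed = trans (count-faces 1F px py P sealed) (trans (stokes g) (trans
      (cong₂ _xor_ (cong₂ _xor_ (cong₂ _xor_ (doors-x0 1F λ ()) doors-xN)
                                (cong (_xor yFace g N) (doors-y0 1F λ ())))
                   (cong₂ _xor_ (doors-z0 1F λ ()) (doors-zN 1F λ ())))
      (xor-identityʳ _)))
      where
      g = doorIn 1F px py P
      doors-xN : xFace g N ≡ false
      doors-xN = xFace-false (On 0F N) (missing 1F 0F (λ ()) _ xN⇒≢0) (pt-x ≤-refl)

  -- The labels on the face x = N, where all the doors end up, are the same for every inner px.
  move-x : ∀ {px px′ py P} → Inner px → Inner px′ → Inner py → Sealed 0F px py P → Sealed 0F px′ py P →
           count px py P ≡ count px′ py P
  move-x {px} {px′} {py} {P} Px Px′ Py s s′ = trans (count-xN Px Py P s) (trans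
    (xFace-cong (On 0F N) (λ {a} {b} {c} qa qb qc → cong (meets₃ P a b c ∧_)
      (cong₃ (same qa) (same qb) (same qc))) (pt-x ≤-refl))
    (sym (count-xN Px′ Py P s′)))
    where
    cong₃ : ∀ {a a′ b b′ c c′} → a ≡ a′ → b ≡ b′ → c ≡ c′ → full 0F a b c ≡ full 0F a′ b′ c′
    cong₃ refl refl refl = refl

    same : ∀ {v} → co v 0F ≡ N → label px py v ≡ label px′ py v
    same = xN⇒label≡ Px Px′

  move-y : ∀ {px py py′ P} → Inner px → Inner py → Inner py′ → Sealed 1F px py P → Sealed 1F px py′ P →
           count px py P ≡ count px py′ P
  move-y {px} {py} {py′} {P} Px Py Py′ s s′ = trans (count-yN Px Py P s) (trans
    (yFace-cong (On 1F N) (λ {a} {b} {c} qa qb qc → cong (meets₃ P a b c ∧_)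
      (cong₃ (same qa) (same qb) (same qc))) (λ x≤ → pt-y x≤ ≤-refl))
    (sym (count-yN Px Py′ P s′)))
    where
    cong₃ : ∀ {a a′ b b′ c c′} → a ≡ a′ → b ≡ b′ → c ≡ c′ → full 1F a b c ≡ full 1F a′ b′ c′
    cong₃ refl refl refl = refl

    same : ∀ {v} → co v 1F ≡ N → label px py v ≡ label px py′ v
    same = yN⇒label≡ Py Py′

  everything : Sub V
  everything _ = true

  -- No triangle misses the whole box, so sealing is vacuous. The doors on the face x = N are
  -- counted by the arcs on its border; only the side y = N can have any, and along it the label
  -- changes from 2 at z = 0 to 3 at z = N.
  sperner : ∀ {px py} → Inner px → Inner py → count px py everything ≡ true
  sperner {px} {py} Px Py = trans (count-xN Px Py everything (λ _ a∉ → ⊥-elim (a∉ _)))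
    (trans (xFace-cong (On 0F N) (λ {a} {b} {c} qa qb qc →
              door-arcs (l a) (l b) (l c) (xN⇒≢0 qa) (xN⇒≢0 qb) (xN⇒≢0 qc)) (pt-x ≤-refl))
    (trans (stokes² arcs N)
    (trans (cong₂ _xor_ (cong₂ _xor_ z0-arcs zN-arcs) (cong₂ _xor_ y0-arcs yN-arcs))
           yN-arcs-total)))
    where
    open Faces Px Py
    l = label px py

    arcs : V → V → Bool
    arcs a b = arc (l a) (l b)

    no-arcs : ∀ k → k ≢ 0F → k ≢ 1F → (f : ℕ → V) → (∀ {i} → i ≤ N → l (f i) ≢ k) →
              sum N (λ i → arcs (f i) (f (suc i))) ≡ false
    no-arcs k ≢0 ≢1 f ≢k = trans (sum-cong N λ i<N →
      full-missing k ≢0 ≢1 (≢k (<⇒≤ i<N) ∘ sym) (≢k i<N ∘ sym)) (sum-false N)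

    z0-arcs : sum N (λ y → arcs (pt N y 0) (pt N (suc y) 0)) ≡ false
    z0-arcs = no-arcs 3F (λ ()) (λ ()) (λ y → pt N y 0) (λ y≤ → z0⇒≢3 (pt-z ≤-refl y≤ z≤n))

    zN-arcs : sum N (λ y → arcs (pt N y N) (pt N (suc y) N)) ≡ false
    zN-arcs = no-arcs 2F (λ ()) (λ ()) (λ y → pt N y N) (λ y≤ → zN⇒≢2 (pt-z ≤-refl y≤ ≤-refl))

    y0-arcs : sum N (λ z → arcs (pt N 0 z) (pt N 0 (suc z))) ≡ false
    y0-arcs = no-arcs 3F (λ ()) (λ ()) (λ z → pt N 0 z) (λ z≤ → y0⇒≢3 (pt-y ≤-refl z≤n z≤))

    end : ℕ → Bool
    end z = does (l (pt N N z) Fin.≟ 3F)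

    yN-arcs : sum N (λ z → arcs (pt N N z) (pt N N (suc z))) ≡ end 0 xor end N
    yN-arcs = trans (sum-cong N λ {z} z<N → arc-ends (l (pt N N z)) (l (pt N N (suc z)))
        (xN⇒≢0 (pt-x ≤-refl ≤-refl (<⇒≤ z<N))) (yN⇒≢1 (pt-y ≤-refl ≤-refl (<⇒≤ z<N)))
        (xN⇒≢0 (pt-x ≤-refl ≤-refl z<N)) (yN⇒≢1 (pt-y ≤-refl ≤-refl z<N)))
      (telescope N end)

    only-3 : ∀ k → k ≢ 0F → k ≢ 1F → k ≢ 2F → does (k Fin.≟ 3F) ≡ true
    only-3 0F ≢0 _ _ = ⊥-elim (≢0 refl)
    only-3 1F _ ≢1 _ = ⊥-elim (≢1 refl)
    only-3 2F _ _ ≢2 = ⊥-elim (≢2 refl)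
    only-3 3F _ _ _ = refl

    yN-arcs-total : end 0 xor end N ≡ true
    yN-arcs-total = cong₂ _xor_ (dec-false (_ Fin.≟ 3F) (z0⇒≢3 (pt-z ≤-refl ≤-refl z≤n)))
      (only-3 _ (xN⇒≢0 (pt-x ≤-refl ≤-refl ≤-refl)) (yN⇒≢1 (pt-y ≤-refl ≤-refl ≤-refl)) (zN⇒≢2 (pt-z ≤-refl ≤-refl ≤-refl)))

  -- Where doors and rainbow tetrahedra can lie

  Close : V → Fin 3 → ℕ → Set
  Close v i c = co v i ≤ suc r + c × c ≤ suc r + co v i

  Far : Fin 3 → ℕ → List V → Set
  Far i c X = ∀ {v} → v ∈ X → ¬ Close v i c

  clique : ∀ {vs} → AllPairs Adj vs → ∀ {x y} → x ∈ vs → y ∈ vs → Adj x y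
  clique (_  ∷ _)  (here refl) (here refl) = Arefl
  clique (as ∷ _)  (here refl) (there y∈)  = All.lookup as y∈
  clique (as ∷ _)  (there x∈)  (here refl) = Asym (All.lookup as x∈)
  clique (_  ∷ ps) (there x∈)  (there y∈)  = clique ps x∈ y∈

  -- The images of a and b lie on different sides of c; undoing the contraction costs r and the edge
  -- to v one more.
  between⇒close : ∀ {i c vs} → AllPairs Adj vs → ∀ {a b v} → a ∈ vs → b ∈ vs → v ∈ vs →
                  co (pos a) i < c → c ≤ co (pos b) i → Close v i c
  between⇒close {i} {c} ps {a} {b} {v} a∈ b∈ v∈ a< b≥ = v≤ , c≤
    where
    open ≤-Reasoning

    v≤ : co v i ≤ suc r + c
    v≤ = begin
      co v i                    ≤⟨ adj-co (clique ps v∈ a∈) i ⟩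
      suc (co a i)              ≤⟨ s≤s (proj₂ (pos-near a i)) ⟩
      suc (r + co (pos a) i)    ≤⟨ s≤s (+-monoʳ-≤ r (<⇒≤ a<)) ⟩
      suc r + c                 ∎

    c≤ : c ≤ suc r + co v i
    c≤ = begin
      c                   ≤⟨ b≥ ⟩
      co (pos b) i        ≤⟨ proj₁ (pos-near b i) ⟩
      r + co b i          ≤⟨ +-monoʳ-≤ r (adj-co (clique ps b∈ v∈) i) ⟩
      r + suc (co v i)    ≡⟨ +-suc r (co v i) ⟩
      suc r + co v i      ∎

  module _ {px py : ℕ} where

    door-witness : ∀ {e a b c} l → door e px py a b c ≡ true → l ≢ e →
                   ∃[ v ] (v ∈ a ∷ b ∷ c ∷ [] × label px py v ≡ l)
    door-witness {e} {a} {b} {c} l eq l≢e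
      with full⁻ {e} {label px py a} {label px py b} {label px py c} eq l
    ... | inj₁ l≡e             = ⊥-elim (l≢e l≡e)
    ... | inj₂ (inj₁ p)        = a , here refl , sym p
    ... | inj₂ (inj₂ (inj₁ p)) = b , there (here refl) , sym p
    ... | inj₂ (inj₂ (inj₂ p)) = c , there (there (here refl)) , sym p

    rainbow-witness : ∀ {a b c d} l → rainbow px py a b c d ≡ true →
                      ∃[ v ] (v ∈ a ∷ b ∷ c ∷ d ∷ [] × label px py v ≡ l)
    rainbow-witness {a} {b} {c} {d} l eq
      with full⁻ {label px py a} {label px py b} {label px py c} {label px py d} eq l
    ... | inj₁ p               = a , here refl , sym p
    ... | inj₂ (inj₁ p)        = b , there (here refl) , sym p
    ... | inj₂ (inj₂ (inj₁ p)) = c , there (there (here refl)) , sym p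
    ... | inj₂ (inj₂ (inj₂ p)) = d , there (there (there (here refl))) , sym p

    -- Labels 1 and 2 occur on different sides of y = py. The value of px does not enter, which is
    -- what allows moves in direction x.
    door-0-close : ∀ {a b c} → AllPairs Adj (a ∷ b ∷ c ∷ []) → door 0F px py a b c ≡ true →
                   ∀ {v} → v ∈ a ∷ b ∷ c ∷ [] → Close v 1F py
    door-0-close ps eq v∈
      with u , u∈ , u1 ← door-witness 1F eq (λ ()) | x , x∈ , x2 ← door-witness 2F eq (λ ()) =
      between⇒close ps u∈ x∈ v∈ (label1⇒y< u u1) (label2⇒y≥ x x2)

    door-1-close : ∀ {a b c} → AllPairs Adj (a ∷ b ∷ c ∷ []) → door 1F px py a b c ≡ true →
                   ∀ {v} → v ∈ a ∷ b ∷ c ∷ [] → Close v 0F px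
    door-1-close ps eq v∈
      with u , u∈ , u0 ← door-witness 0F eq (λ ()) | x , x∈ , x2 ← door-witness 2F eq (λ ()) =
      between⇒close ps u∈ x∈ v∈ (label0⇒x< u u0) (label2⇒x≥ x x2)

    rainbow-close : ∀ {a b c d} → AllPairs Adj (a ∷ b ∷ c ∷ d ∷ []) → rainbow px py a b c d ≡ true →
                    ∀ {v} → v ∈ a ∷ b ∷ c ∷ d ∷ [] → Close v 0F px
    rainbow-close ps eq v∈
      with u , u∈ , u0 ← rainbow-witness 0F eq | x , x∈ , x2 ← rainbow-witness 2F eq =
      between⇒close ps u∈ x∈ v∈ (label0⇒x< u u0) (label2⇒x≥ x x2)

  tet⇒pairs : ∀ {a b c d} → Tetrahedron a b c d → AllPairs Adj (a ∷ b ∷ c ∷ d ∷ [])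
  tet⇒pairs (tet ab ac ad bc bd cd) = (ab ∷ ac ∷ ad ∷ []) ∷ (bc ∷ bd ∷ []) ∷ (cd ∷ []) ∷ [] ∷ []

  -- The count vanishes on branches

  module Vanishing (_≟_ : DecidableEquality V) (B : Sub V) (w : ℕ)
    (flat : ∀ {a b c} → ¬ a ∊ B → ¬ b ∊ B → ¬ c ∊ B → Adj a b → Adj a c → Adj b c →
            pos a ≡ pos b ⊎ pos a ≡ pos c ⊎ pos b ≡ pos c)
    (escape : ∀ i L → length L ≤ w + w → ∃[ c ] (Inner c × Far i c L))
    where

    open Branches _≟_ Adj Asym B w

    opaque
      unfolding label

      label-cong : ∀ {px py u v} → pos u ≡ pos v → label px py u ≡ label px py v
      label-cong {px} {py} = cong (labelAt px py)

    flat-door : ∀ {e px py a b c} → ¬ a ∊ B → ¬ b ∊ B → ¬ c ∊ B → Adj a b → Adj a c → Adj b c →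
                door e px py a b c ≡ false
    flat-door {e} {px} {py} {a} {b} {c} a∉ b∉ c∉ ab ac bc = full-repeated e (label px py a) (label px py b) (label px py c)
      ([ inj₁ ∘ label-cong , inj₂ ∘ [ inj₁ ∘ label-cong , inj₂ ∘ label-cong ]′ ]′ (flat a∉ b∉ c∉ ab ac bc))

    -- A door next to D but outside it would avoid X, hence all of B as D is closed; but a triangle
    -- outside B has two vertices with the same image and is no door.
    branch-sealed : ∀ e {px py X D} → Branch X D →
      (∀ {a b c} → AllPairs Adj (a ∷ b ∷ c ∷ []) → door e px py a b c ≡ true →
       ∀ {v} → v ∈ a ∷ b ∷ c ∷ [] → v ∉ X) → Sealed e px py D
    branch-sealed e {px} {py} {X} {D} br away {v} {a} {b} {c} v∊D a∉ b∉ c∉ va vb vc ab ac bc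
      with door e px py a b c in eq
    ... | false = refl
    ... | true  = trans (sym eq) (flat-door (beyond a∉ va (here refl)) (beyond b∉ vb (there (here refl)))
                                            (beyond c∉ vc (there (there (here refl)))) ab ac bc)
      where
      beyond : ∀ {u} → ¬ u ∊ D → Adj v u → u ∈ a ∷ b ∷ c ∷ [] → ¬ u ∊ B
      beyond u∉D vu u∈ u∊B =
        [ u∉D , away ((ab ∷ ac ∷ []) ∷ (bc ∷ []) ∷ [] ∷ []) eq u∈ ]′ (branch-closed br v∊D u∊B vu)

    sealed-0 : ∀ {px py X D} → Branch X D → Far 1F py X → Sealed 0F px py D
    sealed-0 br far = branch-sealed 0F br (λ ps eq v∈ v∈X → far v∈X (door-0-close ps eq v∈))

    sealed-1 : ∀ {px py X D} → Branch X D → Far 0F px X → Sealed 1F px py D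
    sealed-1 br far = branch-sealed 1F br (λ ps eq v∈ v∈X → far v∈X (door-1-close ps eq v∈))

    opaque
      unfolding count

      count-∅ : ∀ {px py} → count px py ∅ ≡ false
      count-∅ = total-false

    ∨≡xor : ∀ a b → (a ≡ true → b ≡ true → false ≡ true) → a ∨ b ≡ a xor b
    ∨≡xor false b     _ = refl
    ∨≡xor true  false _ = refl
    ∨≡xor true  true  f = sym (f refl refl)

    meets₄-∪ : ∀ D E a b c d → meets₄ (D ∪ E) a b c d ≡ meets₄ D a b c d ∨ meets₄ E a b c d
    meets₄-∪ D E a b c d = ∨-solve 8 (λ a b c d a′ b′ c′ d′ →
      (a :∨ a′) :∨ ((b :∨ b′) :∨ ((c :∨ c′) :∨ (d :∨ d′))) ≗ᵇ (a :∨ (b :∨ (c :∨ d))) :∨ (a′ :∨ (b′ :∨ (c′ :∨ d′))))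
      refl (D a) (D b) (D c) (D d) (E a) (E b) (E c) (E d)

    opaque
      unfolding count

      -- No tetrahedron meets both branches, since an edge from D to E would leave D without
      -- entering X.
      count-∪ : ∀ {px py X D E} → Branch X D → Branch X E → (∀ {v} → v ∊ D → ¬ v ∊ E) →
                count px py (D ∪ E) ≡ count px py D xor count px py E
      count-∪ {px} {py} {X} {D} {E} br br′ disjoint = trans (total-cong λ {a} {b} {c} {d} t →
          trans (cong (_∧ R a b c d) (trans (meets₄-∪ D E a b c d) (∨≡xor (meets₄ D a b c d) (meets₄ E a b c d) (clash t))))
                (∧-distribʳ-xor (R a b c d) (meets₄ D a b c d) (meets₄ E a b c d)))
        (total-xor (λ a b c d → meets₄ D a b c d ∧ R a b c d) (λ a b c d → meets₄ E a b c d ∧ R a b c d))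
        where
        R : V → V → V → V → Bool
        R = rainbow px py

        meets⇒∈ : ∀ P {a b c d} → meets₄ P a b c d ≡ true → ∃[ v ] (v ∈ a ∷ b ∷ c ∷ d ∷ [] × v ∊ P)
        meets⇒∈ P {a} {b} {c} {d} eq with meets₄? P {a} {b} {c} {d}
        ... | inj₁ (_ , inj₁ p)               = _ , here refl , p
        ... | inj₁ (_ , inj₂ (inj₁ p))        = _ , there (here refl) , p
        ... | inj₁ (_ , inj₂ (inj₂ (inj₁ p))) = _ , there (there (here refl)) , p
        ... | inj₁ (_ , inj₂ (inj₂ (inj₂ p))) = _ , there (there (there (here refl))) , p
        ... | inj₂ (a∉ , b∉ , c∉ , d∉) = contradiction (trans (sym eq) (∉⇒meets₄ P a∉ b∉ c∉ d∉)) λ ()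

        clash : ∀ {a b c d} → Tetrahedron a b c d → meets₄ D a b c d ≡ true → meets₄ E a b c d ≡ true → false ≡ true
        clash t eqD eqE with x , x∈ , x∊D ← meets⇒∈ D eqD | y , y∈ , y∊E ← meets⇒∈ E eqE =
          ⊥-elim ([ (λ y∊D → disjoint y∊D y∊E) , branch-avoids br′ y∊E ]′
            (branch-closed br x∊D (branch⊆B br′ y∊E) (clique (tet⇒pairs t) x∈ y∈)))

    opaque
      unfolding count

      -- Rainbow tetrahedra are close to the plane x = px, so none has a vertex in Y.
      count-up : ∀ {px py} X Y D → Far 0F px Y → count px py (D ∪ Y ─ X) ≡ count px py D
      count-up {px} {py} X Y D far = total-cong same
        where
        same : ∀ {a b c d} → Tetrahedron a b c d → meets₄ (D ∪ Y ─ X) a b c d ∧ rainbow px py a b c d ≡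
                                                   meets₄ D a b c d ∧ rainbow px py a b c d
        same {a} {b} {c} {d} t with rainbow px py a b c d in eq
        ... | false = trans (∧-zeroʳ _) (sym (∧-zeroʳ _))
        ... | true  = cong (_∧ true) (cong₂ _∨_ (at (here refl)) (cong₂ _∨_ (at (there (here refl)))
                        (cong₂ _∨_ (at (there (there (here refl)))) (at (there (there (there (here refl))))))))
          where
          at : ∀ {v} → v ∈ a ∷ b ∷ c ∷ d ∷ [] → (D ∪ Y ─ X) v ≡ D v
          at {v} v∈ = trans (cong (D v ∨_) (∉⇒false (Y ─ X)
            (λ v∊ → far (proj₁ (─⁻ v∊)) (rainbow-close (tet⇒pairs t) eq v∈)))) (∨-identityʳ (D v))

    branch-vanishes : ∀ {X D} → Branch X D → length X ≤ w → ∀ {px py} → Inner px → Inner py →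
                      Far 0F px X ⊎ Far 1F py X → count px py D ≡ false
    branch-vanishes nil _ _ _ _ = count-∅
    branch-vanishes (join br br′ disjoint) X≤w Px Py far = trans (count-∪ br br′ disjoint)
      (cong₂ _xor_ (branch-vanishes br X≤w Px Py far) (branch-vanishes br′ X≤w Px Py far))
    branch-vanishes {X} u@(up {Y = Y} {D} br Y≤w _ _ _) X≤w {px} {py} Px Py far
      with qx , Qx , farx ← escape 0F (X ++ Y) (≤-trans (≤-reflexive (length-++ X)) (+-mono-≤ X≤w Y≤w))
         | qy , Qy , fary ← escape 1F (X ++ Y) (≤-trans (≤-reflexive (length-++ X)) (+-mono-≤ X≤w Y≤w)) =
      trans (moved far) (trans (count-up X Y D (farx ∘ ∈-++⁺ʳ X)) (branch-vanishes br Y≤w Qx Qy (inj₁ (farx ∘ ∈-++⁺ʳ X))))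
      where
      moved : Far 0F px X ⊎ Far 1F py X → count px py (D ∪ Y ─ X) ≡ count qx qy (D ∪ Y ─ X)
      -- The coordinate known to be far from X seals the branch for the first move, and the
      -- coordinate reached by it seals the branch for the second.
      moved (inj₁ far-x) = trans (move-y Px Py Qy (sealed-1 u far-x) (sealed-1 u far-x))
        (move-x Px Qx Qy (sealed-0 u (fary ∘ ∈-++⁺ˡ)) (sealed-0 u (fary ∘ ∈-++⁺ˡ)))
      moved (inj₂ far-y) = trans (move-x Px Qx Py (sealed-0 u far-y) (sealed-0 u far-y))
        (move-y Qx Py Qy (sealed-1 u (farx ∘ ∈-++⁺ˡ)) (sealed-1 u (farx ∘ ∈-++⁺ˡ)))

    opaque
      unfolding count

      -- A rainbow tetrahedron outside B would have a door outside B.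
      count-all : ∀ {px py D} → (∀ {v} → v ∊ B → v ∊ D) → count px py D ≡ count px py everything
      count-all {px} {py} {D} B⊆D = total-cong same
        where
        same : ∀ {a b c d} → Tetrahedron a b c d → meets₄ D a b c d ∧ rainbow px py a b c d ≡ rainbow px py a b c d
        same {a} {b} {c} {d} (tet ab ac ad bc bd cd) with meets₄? D {a} {b} {c} {d}
        ... | inj₁ (eq , _) = cong (_∧ rainbow px py a b c d) eq
        ... | inj₂ (a∉ , b∉ , c∉ , d∉) = trans (cong (_∧ rainbow px py a b c d) (∉⇒meets₄ D a∉ b∉ c∉ d∉))
          (sym (trans (full-faces 0F (label px py a) (label px py b) (label px py c) (label px py d))
            (cong₂ _xor_ (cong₂ _xor_ (flat-door (b∉ ∘ B⊆D) (c∉ ∘ B⊆D) (d∉ ∘ B⊆D) bc bd cd)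
                                     (flat-door (a∉ ∘ B⊆D) (c∉ ∘ B⊆D) (d∉ ∘ B⊆D) ac ad cd))
                         (cong₂ _xor_ (flat-door (a∉ ∘ B⊆D) (b∉ ∘ B⊆D) (d∉ ∘ B⊆D) ab ad bd)
                                     (flat-door (a∉ ∘ B⊆D) (b∉ ∘ B⊆D) (c∉ ∘ B⊆D) ab ac bc)))))

    no-branch : ∀ {D} → Branch [] D → ¬ (∀ {v} → v ∊ B → v ∊ D)
    no-branch br B⊆D with c , Pc , _ ← escape 0F [] z≤n =
      contradiction (trans (sym (branch-vanishes br z≤n Pc Pc (inj₁ λ ()))) (trans (count-all B⊆D) (sperner Pc Pc))) λ ()

-- The cube

module Cube (N : ℕ) where

  n : ℕ
  n = suc N

  V : Set
  V = Vertex (Q n)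

  opaque
    co : V → Fin 3 → ℕ
    co = coord n

    -- Reduction modulo n only makes `pt` total; it changes nothing for coordinates up to N.
    residues : ℕ → ℕ → ℕ → Fin 3 → Fin n
    residues x y z 0F = x mod n
    residues x y z 1F = y mod n
    residues x y z 2F = z mod n

    pt : ℕ → ℕ → ℕ → V
    pt x y z = funToFin (residues x y z)

    toℕ-mod : ∀ {x} → x ≤ N → toℕ (x mod n) ≡ x
    toℕ-mod {x} x≤N = trans (Fin.toℕ-fromℕ< _) (m<n⇒m%n≡m (s≤s x≤N))

    pt-x : ∀ {x y z} → x ≤ N → y ≤ N → z ≤ N → co (pt x y z) 0F ≡ x
    pt-x {x} {y} {z} x≤N y≤N z≤N = trans (cong toℕ (Fin.finToFun-funToFin (residues x y z) 0F)) (toℕ-mod x≤N)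

    pt-y : ∀ {x y z} → x ≤ N → y ≤ N → z ≤ N → co (pt x y z) 1F ≡ y
    pt-y {x} {y} {z} x≤N y≤N z≤N = trans (cong toℕ (Fin.finToFun-funToFin (residues x y z) 1F)) (toℕ-mod y≤N)

    pt-z : ∀ {x y z} → x ≤ N → y ≤ N → z ≤ N → co (pt x y z) 2F ≡ z
    pt-z {x} {y} {z} x≤N y≤N z≤N = trans (cong toℕ (Fin.finToFun-funToFin (residues x y z) 2F)) (toℕ-mod z≤N)

    co≤N : ∀ v i → co v i ≤ N
    co≤N v i = s≤s⁻¹ (Fin.toℕ<n (finToFun {n} {3} v i))

    pt-co : ∀ v → pt (co v 0F) (co v 1F) (co v 2F) ≡ v
    pt-co v = trans (cong₂ combine (at 0F) (cong₂ combine (at 1F) (cong₂ (combine {n} {1}) (at 2F) refl)))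
                    (Fin.funToFin-finToFin {3} {n} v)
      where
      at : ∀ i → co v i mod n ≡ finToFun {n} {3} v i
      at i = Fin.toℕ-injective (toℕ-mod (co≤N v i))

  -- Adjacency in `Q n` made reflexive, as every vertex is a `Step` from itself.
  Touch : Rel V _
  Touch u v = Step n u v ⊎ Step n v u

  touch-refl : ∀ {v} → Touch v v
  touch-refl = inj₁ λ i → ≤-refl , n≤1+n _

  touch? : ∀ u v → Dec (Touch u v)
  touch? u v = step? n u v ⊎-dec step? n v u

  opaque
    unfolding co

    touch-co : ∀ {u v} → Touch u v → ∀ i → co u i ≤ suc (co v i)
    touch-co (inj₁ s) i = m≤n⇒m≤1+n (proj₁ (s i))
    touch-co (inj₂ s) i = proj₂ (s i)

  ⊑⇒≤ : ∀ {x y} → x ⊑ y → x ≤ y × y ≤ suc x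
  ⊑⇒≤ stay = ≤-refl , n≤1+n _
  ⊑⇒≤ rise = n≤1+n _ , ≤-refl

  opaque
    unfolding co

    pt-touch : ∀ {x y z x′ y′ z′} → ⦃ x ⊑ x′ ⦄ → ⦃ y ⊑ y′ ⦄ → ⦃ z ⊑ z′ ⦄ →
               ⦃ x′ ≤ N ⦄ → ⦃ y′ ≤ N ⦄ → ⦃ z′ ≤ N ⦄ → Touch (pt x y z) (pt x′ y′ z′)
    pt-touch {x} {y} {z} {x′} {y′} {z′} ⦃ dx ⦄ ⦃ dy ⦄ ⦃ dz ⦄ ⦃ x′≤ ⦄ ⦃ y′≤ ⦄ ⦃ z′≤ ⦄ = inj₁ step
      where
      x≤ : x ≤ N
      x≤ = ≤-trans (proj₁ (⊑⇒≤ dx)) x′≤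
      y≤ : y ≤ N
      y≤ = ≤-trans (proj₁ (⊑⇒≤ dy)) y′≤
      z≤ : z ≤ N
      z≤ = ≤-trans (proj₁ (⊑⇒≤ dz)) z′≤

      step : Step n (pt x y z) (pt x′ y′ z′)
      step 0F = subst₂ (λ a b → a ≤ b × b ≤ suc a) (sym (pt-x x≤ y≤ z≤)) (sym (pt-x x′≤ y′≤ z′≤)) (⊑⇒≤ dx)
      step 1F = subst₂ (λ a b → a ≤ b × b ≤ suc a) (sym (pt-y x≤ y≤ z≤)) (sym (pt-y x′≤ y′≤ z′≤)) (⊑⇒≤ dy)
      step 2F = subst₂ (λ a b → a ≤ b × b ≤ suc a) (sym (pt-z x≤ y≤ z≤)) (sym (pt-z x′≤ y′≤ z′≤)) (⊑⇒≤ dz)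

  around : ℕ → List ℕ
  around k = k ∸ 1 ∷ k ∷ suc k ∷ []

  ∈-around : ∀ {k l} → l ≤ suc k → k ≤ suc l → l ∈ around k
  ∈-around {k} {l} l≤ k≤ with m≤n⇒m<n∨m≡n l≤
  ... | inj₂ refl = there (there (here refl))
  ... | inj₁ (s≤s l≤k) with m≤n⇒m<n∨m≡n l≤k
  ...   | inj₂ refl = there (here refl)
  ...   | inj₁ l<k with refl ← ≤-antisym k≤ l<k = here refl

  -- All 27 triples are kept, even those that leave the cube and land elsewhere: only the length and
  -- the presence of the true neighbours matter.
  nbrs : V → List V
  nbrs v = cartesianProductWith (λ f z → f z)
    (cartesianProductWith pt (around (co v 0F)) (around (co v 1F))) (around (co v 2F))

  ∈-nbrs : ∀ {u v} → Touch u v → v ∈ nbrs u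
  ∈-nbrs {u} {v} uv = subst (_∈ nbrs u) (pt-co v)
    (∈-cartesianProductWith⁺ (λ f z → f z) (∈-cartesianProductWith⁺ pt (at 0F) (at 1F)) (at 2F))
    where
    at : ∀ i → co v i ∈ around (co u i)
    at i = ∈-around (touch-co (swap uv) i) (touch-co uv i)

sub : ∀ {m} → Subset m → Sub (Fin m)
sub = Vec.lookup

sub⁺ : ∀ {m} {S : Subset m} {x} → x Subset.∈ S → x ∊ sub S
sub⁺ x∈ = subst T (sym (Vec.[]=⇒lookup x∈)) _

sub⁻ : ∀ {m} {S : Subset m} {x} → x ∊ sub S → x Subset.∈ S
sub⁻ {S = S} {x} x∊ with Vec.lookup S x in eq
... | true = Vec.lookup⇒[]= x S eq

pred-≤ : ∀ m {t} → ℤ.+ m ℤ.- 1ℤ ℤ.≤ ℤ.+ t → m ≤ suc t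
pred-≤ zero    _  = z≤n
pred-≤ (suc m) m≤ = s≤s (ℤ.drop‿+≤+ m≤)

bag-size : ∀ {G t} (TD : TreeDecomposition G) → width TD ℤ.≤ ℤ.+ t →
           ∀ s → ∣ TreeDecomposition.bag TD s ∣ ≤ suc t
bag-size TD w≤t s = ≤-trans (All.lookup (xs≤max 0 sizes) (∈-tabulate⁺ s)) (pred-≤ (max 0 sizes) w≤t)
  where
  sizes : List ℕ
  sizes = List.tabulate λ t → ∣ TreeDecomposition.bag TD t ∣

module _ (N t : ℕ) (A : VertexSet (Q (suc N))) where
  open Cube N

  private
    B : Sub V
    B = sub (∁ A)

    ι-adj : ∀ {x y} → Touch (nth (∁ A) x) (nth (∁ A) y) → x ≡ y ⊎ Graph.Adj (Q n ∖ A) x y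
    ι-adj {x} {y} xy with x Fin.≟ y
    ... | yes x≡y = inj₁ x≡y
    ... | no  x≢y = inj₂ (x≢y ∘ nth-injective (∁ A) , xy)

  rootedComplement : tw[ Q n ∖ A ]≤ t →
    ∃[ D ] (Branches.Branch Fin._≟_ Touch swap B (suc t) [] D × (∀ {v} → v ∊ B → v ∊ D))
  rootedComplement (_ , record { attained = TD , refl } , w≤t)
    with D , b , B⊆D ← Rooting.rooted (Q n ∖ A) TD Fin._≟_ Touch swap B (nth (∁ A))
        (nth-injective (∁ A)) (λ x → sub⁺ (nth-∈ (∁ A) x)) (λ v∊ → nth-surjective (∁ A) (sub⁻ v∊))
        (λ {x} {y} → ι-adj {x} {y}) (suc t) (bag-size TD w≤t) = D , b , B⊆D

-- Positions far from a few vertices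

module Cuts (w r : ℕ) where

  opaque
    -- Close means within r + 1, so with spacing 2r + 4 no coordinate is close to two cuts. The side
    -- has room for 2w + 1 cuts with a margin of r + 2 at both ends.
    spacing : ℕ
    spacing = suc (suc r) + suc (suc r)

    cut : ℕ → ℕ
    cut i = suc (suc r) + i * spacing

    side : ℕ
    side = suc (w + w) * spacing

    cut-inner : ∀ {i} → i ≤ w + w → cut i + r ≤ side
    cut-inner {i} i≤ = begin
      (suc (suc r) + i * spacing) + r
          ≡⟨ solve 2 (λ r s → (con 2 :+ r :+ s) :+ r := ((con 2 :+ r) :+ r) :+ s) refl r (i * spacing) ⟩
      (suc (suc r) + r) + i * spacing         ≤⟨ +-monoˡ-≤ (i * spacing) (+-monoʳ-≤ (suc (suc r)) (m≤n⇒m≤1+n (n≤1+n r))) ⟩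
      suc i * spacing                         ≤⟨ *-monoˡ-≤ spacing (s≤s i≤) ⟩
      side                                    ∎
      where
      open ≤-Reasoning
  
    cut-above : ∀ i → r < cut i
    cut-above i = s≤s (m≤n⇒m≤1+n (m≤m+n r (i * spacing)))

  CloseTo : ℕ → ℕ → Set
  CloseTo x c = x ≤ suc r + c × c ≤ suc r + x

  closeTo? : ∀ x c → Dec (CloseTo x c)
  closeTo? x c = (x ≤? suc r + c) ×-dec (c ≤? suc r + x)

  opaque
    unfolding cut

    close-unique : ∀ {x i j} → i < j → CloseTo x (cut i) → ¬ CloseTo x (cut j)
    close-unique {x} {i} {j} i<j (x≤ , _) (_ , ≤x) = <⇒≱ {suc r + (suc r + cut i)} {cut j} gap
      (≤-trans ≤x (+-monoʳ-≤ (suc r) x≤))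
      where
      open ≤-Reasoning
  
      gap : suc r + (suc r + cut i) < cut j
      gap = begin-strict
        suc r + (suc r + cut i)         <⟨ +-mono-< (n<1+n (suc r)) (+-monoˡ-< (cut i) (n<1+n (suc r))) ⟩
        suc (suc r) + (suc (suc r) + cut i)
          ≡⟨ solve 2 (λ a b → a :+ (a :+ (a :+ b)) := a :+ ((a :+ a) :+ b)) refl (suc (suc r)) (i * spacing) ⟩
        suc (suc r) + suc i * spacing   ≤⟨ +-monoʳ-≤ (suc (suc r)) (*-monoˡ-≤ spacing i<j) ⟩
        cut j                           ∎

  uncut : ∀ {V : Set} (f : V → ℕ) m L → length L ≤ m →
          ∃[ i ] (i ≤ m × (∀ {v} → v ∈ L → ¬ CloseTo (f v) (cut i)))
  uncut f zero    []  _   = 0 , z≤n , λ ()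
  uncut f (suc m) L L≤m with any? (λ v → closeTo? (f v) (cut (suc m))) L
  ... | no none = suc m , ≤-refl , λ v∈ close → none (lose v∈ close)
  ... | yes some with i , i≤m , far ← uncut f m (filter (λ v → ¬? (closeTo? (f v) (cut (suc m)))) L)
          (s≤s⁻¹ (≤-trans (filter-notAll _ L (Any.map (λ close far → far close) some)) L≤m)) =
    i , m≤n⇒m≤1+n i≤m , λ v∈ close → far (∈-filter⁺ _ v∈ (close-unique (s≤s i≤m) close)) close

-- The contradiction

boxSide : ℕ → ℕ → ℕ
boxSide Δ w = Cuts.side w (radiusBound Δ w)

module Obstruction {V : Set} (_≟_ : DecidableEquality V) (vertices : List V) (∈-vertices : ∀ v → v ∈ vertices)
  (Adj : Rel V 0ℓ) (Arefl : ∀ {v} → Adj v v) (Asym : Symmetric Adj) (Adj? : Decidable Adj)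
  (Δ : ℕ) (nbrs : V → List V) (nbrs≤Δ : ∀ v → length (nbrs v) ≤ Δ)
  (∈-nbrs : ∀ {u v} → Adj u v → v ∈ nbrs u)
  (co : V → Fin 3 → ℕ) (adj-co : ∀ {u v} → Adj u v → ∀ i → co u i ≤ suc (co v i))
  (w : ℕ) (pt : ℕ → ℕ → ℕ → V)
  (pt-x : ∀ {x y z} → x ≤ boxSide Δ w → y ≤ boxSide Δ w → z ≤ boxSide Δ w → co (pt x y z) 0F ≡ x)
  (pt-y : ∀ {x y z} → x ≤ boxSide Δ w → y ≤ boxSide Δ w → z ≤ boxSide Δ w → co (pt x y z) 1F ≡ y)
  (pt-z : ∀ {x y z} → x ≤ boxSide Δ w → y ≤ boxSide Δ w → z ≤ boxSide Δ w → co (pt x y z) 2F ≡ z)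
  (pt-adj : ∀ {x y z x′ y′ z′} → ⦃ x ⊑ x′ ⦄ → ⦃ y ⊑ y′ ⦄ → ⦃ z ⊑ z′ ⦄ →
            ⦃ x′ ≤ boxSide Δ w ⦄ → ⦃ y′ ≤ boxSide Δ w ⦄ → ⦃ z′ ≤ boxSide Δ w ⦄ → Adj (pt x y z) (pt x′ y′ z′))
  where

  private
    r : ℕ
    r = radiusBound Δ w

  open Cuts w r hiding (side)

  -- Labels look at coordinates only, so distance in coordinates takes the place of graph distance.
  Near : ℕ → Rel V _
  Near k u v = ∀ i → co u i ≤ k + co v i × co v i ≤ k + co u i

  near-trans : ∀ {k l u v x} → Near k u v → Near l v x → Near (k + l) u x
  near-trans {k} {l} {u} {v} {x} uv vx i =
    ≤-trans (proj₁ (uv i)) (≤-trans (+-monoʳ-≤ k (proj₁ (vx i))) (≤-reflexive (sym (+-assoc k l _)))) ,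
    ≤-trans (proj₂ (vx i)) (≤-trans (+-monoʳ-≤ l (proj₂ (uv i)))
      (≤-reflexive (trans (sym (+-assoc l k _)) (cong (_+ co u i) (+-comm l k)))))

  near-mono : ∀ {k l u v} → k ≤ l → Near k u v → Near l u v
  near-mono {u = u} {v} k≤l uv i =
    ≤-trans (proj₁ (uv i)) (+-monoˡ-≤ (co v i) k≤l) , ≤-trans (proj₂ (uv i)) (+-monoˡ-≤ (co u i) k≤l)

  module _ (B F : Sub V) (∉B⇒∈F : ∀ {v} → ¬ v ∊ B → v ∊ F)
    {D} (b : Branches.Branch _≟_ Adj Asym B w [] D) (B⊆D : ∀ {v} → v ∊ B → v ∊ D)
    {E} (e : Branches.Branch _≟_ Adj Asym F w [] E) (F⊆E : ∀ {v} → v ∊ F → v ∊ E)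
    where

    module Colours = Colouring _≟_ Adj Asym Adj? Δ nbrs nbrs≤Δ ∈-nbrs Near
      (λ _ → ≤-refl , ≤-refl) (λ uv i → proj₂ (uv i) , proj₁ (uv i)) near-mono near-trans
      (λ uv i → adj-co uv i , adj-co (Asym uv) i) F w

    module P = Colours.Partition (Colours.partition e F⊆E
      _ vertices F (λ v∊ → v∊) (λ {v} _ → ∈-vertices v) ≤-refl [] z≤n true)

    -- All of F is coloured, since F is the set with a decomposition at hand; the representatives
    -- are used only outside B.
    pos : V → V
    pos v = if B v then v else P.rep v

    pos-near : ∀ v i → co (pos v) i ≤ r + co v i × co v i ≤ r + co (pos v) i
    pos-near v with v ∊? B
    ... | yes v∊B rewrite ∊⇒true B v∊B = λ i → m≤n+m _ r , m≤n+m _ r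
    ... | no  v∉B rewrite ∉⇒false B v∉B = P.near (∉B⇒∈F v∉B)

    pos-rep : ∀ {v} → ¬ v ∊ B → pos v ≡ P.rep v
    pos-rep v∉B rewrite ∉⇒false B v∉B = refl

    two-equal : ∀ (a b c : Bool) → a ≡ b ⊎ a ≡ c ⊎ b ≡ c
    two-equal true  true  _     = inj₁ refl
    two-equal false false _     = inj₁ refl
    two-equal true  false true  = inj₂ (inj₁ refl)
    two-equal false true  false = inj₂ (inj₁ refl)
    two-equal true  false false = inj₂ (inj₂ refl)
    two-equal false true  true  = inj₂ (inj₂ refl)

    pos-flat : ∀ {a b c} → ¬ a ∊ B → ¬ b ∊ B → ¬ c ∊ B → Adj a b → Adj a c → Adj b c →
               pos a ≡ pos b ⊎ pos a ≡ pos c ⊎ pos b ≡ pos c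
    pos-flat {a} {b} {c} a∉ b∉ c∉ ab ac bc =
      [ inj₁ ∘ same a∉ b∉ ab , inj₂ ∘ [ inj₁ ∘ same a∉ c∉ ac , inj₂ ∘ same b∉ c∉ bc ]′ ]′
        (two-equal (P.colour a) (P.colour b) (P.colour c))
      where
      same : ∀ {u v} → ¬ u ∊ B → ¬ v ∊ B → Adj u v → P.colour u ≡ P.colour v → pos u ≡ pos v
      same u∉ v∉ uv eq = trans (pos-rep u∉) (trans (P.mono (∉B⇒∈F u∉) (∉B⇒∈F v∉) uv eq) (sym (pos-rep v∉)))

    open Parity Adj Arefl Asym co adj-co (boxSide Δ w) pt pt-x pt-y pt-z pt-adj r pos pos-near
      (cut 0) (cut-above 0) (cut-inner z≤n) using (Inner; inner; Far; module Vanishing)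

    escape : ∀ i L → length L ≤ w + w → ∃[ c ] (Inner c × Far i c L)
    escape i L L≤ with k , k≤ , far ← uncut (λ v → co v i) (w + w) L L≤ =
      cut k , inner (cut-above k) (cut-inner k≤) , far

    no-decomposition : ⊥
    no-decomposition = Vanishing.no-branch _≟_ B w pos-flat escape b B⊆D

module _ (t : ℕ) where

  open Cube (boxSide 27 (suc t))

  no-two-sets : (A₀ A₁ : VertexSet (Q n)) → Subset.Empty (A₀ Subset.∩ A₁) → tw[ Q n ∖ A₀ ]≤ t → ¬ tw[ Q n ∖ A₁ ]≤ t
  no-two-sets A₀ A₁ disjoint tw₀ tw₁
    with D , b , B⊆D ← rootedComplement _ t A₀ tw₀ | E , e , F⊆E ← rootedComplement _ t A₁ tw₁ =
    Obstruction.no-decomposition Fin._≟_ (allFin _) ∈-allFin Touch touch-refl swap touch?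
      27 nbrs (λ _ → ≤-refl) ∈-nbrs co touch-co (suc t) pt pt-x pt-y pt-z pt-touch
      (sub (∁ A₀)) (sub (∁ A₁))
      -- Disjointness enters here: a vertex outside B lies in `A₀`, hence not in `A₁`.
      (λ v∉B → sub⁺ (Subset.x∉p⇒x∈∁p λ v∈A₁ → disjoint (_ , Subset.x∈p∩q⁺ (Subset.x∉∁p⇒x∈p (v∉B ∘ sub⁺) , v∈A₁))))
      b B⊆D e F⊆E

corollary2 : ¬ TreewidthFragile 𝒬
corollary2 fragile with t , sets ← fragile 2 (s≤s z≤n)
  with A , disjoint , tw≤t ← sets _ (suc (boxSide 27 (suc t)) , s≤s z≤n , refl) =
  no-two-sets t (A 0F) (A 1F) (disjoint 0F 1F λ ()) (tw≤t 0F) (tw≤t 1F)
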